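{- The numbers $D_m(n)$ and $D_{\geq m}(n)$ defined in the context satisfy, for all integers $0\leq m<n$, the recurrence $$D_m(n)=\sum_{j=1}^m\sum_{i=1}^{n-m-1}\binom{n-m-1}{i-1}D_{\geq j}(i+j-1)\,D_{\geq m-j}(n-j-i),$$ with initial conditions $D_n(n)=1$ for all $n\ge 1$.
   Context: $S_n$ is the set of permutations of $\{1,\ldots,n\}$, written $\pi=\pi_1\cdots\pi_n$. A descent of $\pi$ is an index $i\in\{1,\ldots,n-1\}$ with $\pi_i>\pi_{i+1}$. The plot of $\pi$ is the set of points $(i,\pi_i)$. A hook of $\pi$ is given by a southwest endpoint $(i,\pi_i)$ and a northeast endpoint $(j,\pi_j)$ with $i<j$ and $\pi_i<\pi_j$; it is the L-shaped set $(\{i\}\times[\pi_i,\pi_j])\cup([i,j]\times\{\pi_j\})$. If $\pi$ has descents $d_1<\cdots<d_k$, a valid hook configuration of $\pi$ is a tuple $(H_1,\ldots,H_k)$ of hooks of $\pi$ such that: (1) for each $i$, the southwest endpoint of $H_i$ is $(d_i,\pi_{d_i})$; (2) no point of the plot lies directly above a hook (i.e., if a hook has endpoints $(i,\pi_i)$ and $(j,\pi_j)$ and $i<l<j$, then $\pi_l<\pi_j$); (3) hooks do not intersect each other, except that the northeast endpoint of one hook may be the southwest endpoint of another. $\mathrm{VHC}(\pi)$ is the set of valid hook configurations of $\pi$. The tail length $\mathrm{tl}(\pi)$ of $\pi\in S_n$ is the smallest nonnegative integer $i$ such that $\pi_{n-i}\neq n-i$, where the identity permutation of $S_n$ is understood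 to have tail length $n$. Define $D_m(n)=\sum_{\pi\in S_n,\ \mathrm{tl}(\pi)=m}|\mathrm{VHC}(\pi)|$ and $D_{\geq m}(n)=\sum_{\ell=m}^{n}D_\ell(n)$. Empty sums equal $0$. -}

module Defs where

open import Data.Fin using (Fin; toℕ; opposite; _<_; _≤_)
open import Data.Fin.Properties using (_≟_; _<?_; _≤?_; all?; any?; ¬∀⟶∃¬-smallest)
open import Data.List using (List; [_]; map; filter; length; applyUpTo; allFin; cartesianProduct; cartesianProductWith)
import Data.List as List
open import Data.Nat.ListAction using (sum)
open import Data.Nat using (ℕ; zero; suc; _+_; _∸_)
import Data.Nat as ℕ
open import Data.Product using (_×_; _,_; ∃; proj₁; proj₂)
open import Data.Sum using (_⊎_)
open import Data.Vec using (Vec; []; _∷_; lookup)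
open import Data.Vec.Relation.Unary.AllPairs using (allPairs?)
open import Relation.Binary.PropositionalEquality using (_≡_; _≢_)
open import Relation.Nullary using (Dec; yes; no; ¬?)
open import Relation.Nullary.Decidable using (_×-dec_; _⊎-dec_; _→-dec_)

-- Σ[ a ⋯ b ] f = f a + f (a + 1) + ⋯ + f b, which is 0 when b < a.
Σ[_⋯_] : ℕ → ℕ → (ℕ → ℕ) → ℕ
Σ[ a ⋯ b ] f = sum (map f (applyUpTo (a +_) (suc b ∸ a)))

vectors : ∀ {A : Set} → List A → (k : ℕ) → List (Vec A k)
vectors xs zero    = [ [] ]
vectors xs (suc k) = cartesianProductWith _∷_ xs (vectors xs k)

-- A permutation of {1, …, n} is given in one-line notation, as a word with
-- distinct entries.  Positions and values are both shifted down by one: the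
-- number a ∈ {1, …, n} is the element of Fin n whose toℕ is a ∸ 1.
S : (n : ℕ) → List (Vec (Fin n) n)
S n = filter (allPairs? λ a b → ¬? (a ≟ b)) (vectors (allFin n) n)

IsDescent : ∀ {n} → Vec (Fin n) n → Fin n → Set
IsDescent π i = ∃ λ j → toℕ j ≡ suc (toℕ i) × lookup π j < lookup π i

isDescent? : ∀ {n} (π : Vec (Fin n) n) (i : Fin n) → Dec (IsDescent π i)
isDescent? π i = any? λ j → (toℕ j ℕ.≟ suc (toℕ i)) ×-dec (lookup π j <? lookup π i)

-- In increasing order, since allFin n is.
descents : ∀ {n} → Vec (Fin n) n → List (Fin n)
descents {n} π = filter (isDescent? π) (allFin n)

-- A hook is recorded by the positions (i , j) of its southwest endpoint
-- (i, πᵢ) and its northeast endpoint (j, πⱼ).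
Hook : ℕ → Set
Hook n = Fin n × Fin n

sw ne : ∀ {n} → Hook n → Fin n
sw = proj₁
ne = proj₂

IsHook : ∀ {n} → Vec (Fin n) n → Hook n → Set
IsHook π H = sw H < ne H × lookup π (sw H) < lookup π (ne H)

isHook? : ∀ {n} (π : Vec (Fin n) n) (H : Hook n) → Dec (IsHook π H)
isHook? π H = (sw H <? ne H) ×-dec (lookup π (sw H) <? lookup π (ne H))

-- Membership of the point (x, y) in the L-shaped set
-- ({i} × [πᵢ, πⱼ]) ∪ ([i, j] × {πⱼ}).  Only lattice points are recorded: the
-- segments have integer endpoints, so if two hooks share a point (x, y) of the
-- real plane they also share (⌊x⌋, ⌊y⌋) and (⌈x⌉, ⌈y⌉).
OnHook : ∀ {n} → Vec (Fin n) n → Hook n → Fin n → Fin n → Set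
OnHook π H x y =
    (x ≡ sw H × (lookup π (sw H) ≤ y × y ≤ lookup π (ne H)))
  ⊎ ((sw H ≤ x × x ≤ ne H) × y ≡ lookup π (ne H))

onHook? : ∀ {n} (π : Vec (Fin n) n) (H : Hook n) (x y : Fin n) → Dec (OnHook π H x y)
onHook? π H x y =
        ((x ≟ sw H) ×-dec ((lookup π (sw H) ≤? y) ×-dec (y ≤? lookup π (ne H))))
  ⊎-dec (((sw H ≤? x) ×-dec (x ≤? ne H)) ×-dec (y ≟ lookup π (ne H)))

NEisSW : ∀ {n} → Vec (Fin n) n → Hook n → Hook n → Fin n → Fin n → Set
NEisSW π H H′ x y = (x ≡ ne H × y ≡ lookup π (ne H)) × (x ≡ sw H′ × y ≡ lookup π (sw H′))

neIsSW? : ∀ {n} (π : Vec (Fin n) n) (H H′ : Hook n) (x y : Fin n) → Dec (NEisSW π H H′ x y)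
neIsSW? π H H′ x y = ((x ≟ ne H) ×-dec (y ≟ lookup π (ne H)))
               ×-dec ((x ≟ sw H′) ×-dec (y ≟ lookup π (sw H′)))

NothingAbove : ∀ {n} → Vec (Fin n) n → Hook n → Set
NothingAbove π H = ∀ l → sw H < l → l < ne H → lookup π l < lookup π (ne H)

nothingAbove? : ∀ {n} (π : Vec (Fin n) n) (H : Hook n) → Dec (NothingAbove π H)
nothingAbove? π H = all? λ l →
  (sw H <? l) →-dec ((l <? ne H) →-dec (lookup π l <? lookup π (ne H)))

Compatible : ∀ {n} → Vec (Fin n) n → Hook n → Hook n → Set
Compatible π H H′ = ∀ x y → OnHook π H x y → OnHook π H′ x y →
  NEisSW π H H′ x y ⊎ NEisSW π H′ H x y

compatible? : ∀ {n} (π : Vec (Fin n) n) (H H′ : Hook n) → Dec (Compatible π H H′)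
compatible? π H H′ = all? λ x → all? λ y →
  onHook? π H x y →-dec (onHook? π H′ x y →-dec
    (neIsSW? π H H′ x y ⊎-dec neIsSW? π H′ H x y))

IsVHC : ∀ {n} (π : Vec (Fin n) n) → Vec (Hook n) (length (descents π)) → Set
IsVHC π Hs =
    (∀ i → IsHook π (lookup Hs i))
  × (∀ i → sw (lookup Hs i) ≡ List.lookup (descents π) i)
  × (∀ i → NothingAbove π (lookup Hs i))
  × (∀ i j → i ≢ j → Compatible π (lookup Hs i) (lookup Hs j))

isVHC? : ∀ {n} (π : Vec (Fin n) n) (Hs : Vec (Hook n) (length (descents π))) → Dec (IsVHC π Hs)
isVHC? π Hs =
        all? (λ i → isHook? π (lookup Hs i))
  ×-dec all? (λ i → sw (lookup Hs i) ≟ List.lookup (descents π) i)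
  ×-dec all? (λ i → nothingAbove? π (lookup Hs i))
  ×-dec all? (λ i → all? λ j → ¬? (i ≟ j) →-dec compatible? π (lookup Hs i) (lookup Hs j))

-- Each valid hook configuration is listed exactly once, so the cardinality of
-- VHC π is its length.
VHC : ∀ {n} (π : Vec (Fin n) n) → List (Vec (Hook n) (length (descents π)))
VHC {n} π = filter (isVHC? π)
  (vectors (cartesianProduct (allFin n) (allFin n)) (length (descents π)))

-- For i : Fin n, opposite i is the position and value n − i after the shift by
-- one.  The index i = n is never tested (there is no π₀); it is the value
-- assigned to the identity.
tl : ∀ {n} → Vec (Fin n) n → ℕ
tl {n} π with all? (λ i → lookup π (opposite i) ≟ opposite i)
... | yes _ = n
... | no ¬id = toℕ (proj₁ (¬∀⟶∃¬-smallest n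
        (λ i → lookup π (opposite i) ≡ opposite i)
        (λ i → lookup π (opposite i) ≟ opposite i) ¬id))

D : ℕ → ℕ → ℕ
D m n = sum (map (λ π → length (VHC π)) (filter (λ π → tl π ℕ.≟ m) (S n)))

D≥ : ℕ → ℕ → ℕ
D≥ m n = Σ[ m ⋯ n ] (λ ℓ → D ℓ n)

{-# OPTIONS --safe #-}

-- Read the maximum of a word as the root of a decreasing binary tree, with the
-- words to its left and right as subtrees.  Let c(T, t) be the number of valid
-- hook configurations on the word of T when t larger values, in increasing
-- order, stand to its right.  If the right subtree is empty, the root is one
-- more such value: c(node l leaf, t) = c(l, t + 1).  Otherwise the root is a
-- descent top, whose hook must end at one of the t values; the hooks starting
-- to its left can then only reach the root or the values beyond that endpoint,
-- and those starting to its right only the values before it, so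
-- c(node l r, t) = Σ_{s < t} c(l, t − s) c(r, s).  Summing over all trees, the
-- binomial coefficient chooses the values that lie left of the maximum; and a
-- word of tail length m followed by nothing counts like a word of tail length 0
-- followed by m larger values.
module Submission where

open import Defs
open import Data.Bool using (if_then_else_; true; false)
open import Data.Empty using (⊥; ⊥-elim)
open import Data.Fin using (Fin; zero; suc; toℕ; opposite; inject₁; fromℕ; fromℕ<)
import Data.Fin as Fin
import Data.Fin.Properties as Fin
open import Data.List using (List; []; _∷_; _++_; [_]; map; length; concatMap; applyUpTo; applyDownFrom; cartesianProductWith; reverse; tabulate; allFin; filter)
import Data.List as List
open import Data.List.Properties using (map-++; map-∘; map-cong; map-applyUpTo; map-tabulate; map-concatMap; applyUpTo-∷ʳ; reverse-applyUpTo; reverse-++; unfold-reverse; length-reverse; length-tabulate; length-map; concatMap-cong; tabulate-cong; ∷-injective; ∷-injectiveʳ; ++-cancelˡ; ++-identityʳ; ++-assoc; filter-++; filter-accept; filter-reject)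
open import Data.List.Membership.Propositional using (_∈_; _∉_)
open import Data.List.Membership.Propositional.Properties
open import Data.List.Relation.Binary.Disjoint.Propositional using (Disjoint)
open import Data.List.Relation.Binary.Permutation.Propositional using (_↭_; ↭-refl; ↭-sym; ↭-trans; ↭-prep; ↭⇒↭ₛ)
import Data.List.Relation.Binary.Permutation.Propositional.Properties as Perm
import Data.List.Relation.Binary.Permutation.Setoid.Properties as PermSetoid
open import Data.List.Relation.Binary.Subset.Propositional using (_⊆_)
open import Data.List.Relation.Unary.All using (All; []; _∷_)
import Data.List.Relation.Unary.All as All
import Data.List.Relation.Unary.All.Properties as All
open import Data.List.Relation.Unary.AllPairs using (AllPairs; []; _∷_)
import Data.List.Relation.Unary.AllPairs as AllPairs
import Data.List.Relation.Unary.AllPairs.Properties as AllPairs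
open import Data.List.Relation.Unary.Any using (here; there)
open import Data.List.Relation.Unary.Unique.Propositional using (Unique)
import Data.List.Relation.Unary.Unique.Propositional.Properties as Unique
open import Data.Nat using (ℕ; zero; suc; _+_; _*_; _∸_; _<_; _≤_; z≤n; s≤s; s≤s⁻¹)
import Data.Nat as ℕ
open import Data.Nat.Combinatorics using (_C_; nCn≡1; nCk+nC[k+1]≡[n+1]C[k+1]; k>n⇒nCk≡0)
open import Data.Nat.ListAction using (sum)
open import Data.Nat.ListAction.Properties using (sum-++; sum-↭)
open import Data.Nat.Properties
open import Algebra.Properties.CommutativeSemigroup +-commutativeSemigroup using (interchange)
open import Data.Product using (_×_; _,_; proj₁; proj₂; ∃; ∃₂)
open import Data.Sum using (_⊎_; inj₁; inj₂)
open import Data.Unit using (⊤; tt)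
open import Data.Vec using (Vec; []; _∷_; toList; fromList; lookup)
import Data.Vec.Properties as Vec
import Data.Vec.Relation.Unary.All.Properties as Allᵛ
open import Data.Vec.Relation.Unary.AllPairs using (allPairs?; []; _∷_) renaming (AllPairs to AllPairsᵛ)
open import Function using (_∘_; id; const)
open import Level using (0ℓ)
open import Relation.Binary using (Rel; Tri; tri<; tri≈; tri>)
open import Relation.Binary.PropositionalEquality hiding ([_])
open import Relation.Nullary using (¬_; ¬?; does; yes; no; contradiction)
open import Relation.Nullary.Decidable using (dec-true; dec-false)
open import Relation.Unary using (Decidable)

-- Tree labels have two meanings. To sum over `S n` they are values, and the flattened trees over
-- the values of `Fin n` run through the permutations once each. To place hooks in a fixed
-- permutation they are positions, ordered through `lookup π`. The two trees have the same shape,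
-- and c depends on the shape alone.
--
-- The induction on hooks must survive the removal of endpoints: after the root's hook has chosen
-- one, each subtree keeps only some of the t larger values, and these are no longer consecutive.
-- The invariant therefore says that each remaining endpoint exceeds every position between the
-- segment and itself, including positions that have been removed. Hooks ending there then
-- automatically have nothing above them.
--
-- D≥ enters through the parameter t: a word of length k followed by j larger values in increasing
-- order is a word of length j + k with tail length at least j, so D≥ j (j + k) is the sum of c(T,
-- j) over the trees with k labels. With j = t - s and i - 1 labels on the left, the two factors at
-- the root become the two factors of the recurrence.

private variable
  A B X Y : Set

-- Finite sums

∑ : ℕ → (ℕ → ℕ) → ℕ
∑ n f = sum (applyUpTo f n)

∑ₗ : List A → (A → ℕ) → ℕ
∑ₗ xs f = sum (map f xs)

∑-cong : ∀ n {f g : ℕ → ℕ} → (∀ i → i < n → f i ≡ g i) → ∑ n f ≡ ∑ n g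
∑-cong zero    h = refl
∑-cong (suc n) h = cong₂ _+_ (h 0 (s≤s z≤n)) (∑-cong n (λ i i<n → h (suc i) (s≤s i<n)))

∑-∷ʳ : ∀ n (f : ℕ → ℕ) → ∑ (suc n) f ≡ ∑ n f + f n
∑-∷ʳ n f = begin
  sum (applyUpTo f (suc n))       ≡⟨ cong sum (applyUpTo-∷ʳ f n) ⟨
  sum (applyUpTo f n ++ [ f n ])  ≡⟨ sum-++ (applyUpTo f n) [ f n ] ⟩
  ∑ n f + (f n + 0)               ≡⟨ cong (∑ n f +_) (+-identityʳ (f n)) ⟩
  ∑ n f + f n                     ∎
  where open ≡-Reasoning

∑-+ : ∀ n (f g : ℕ → ℕ) → ∑ n (λ i → f i + g i) ≡ ∑ n f + ∑ n g
∑-+ zero    f g = refl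
∑-+ (suc n) f g = trans (cong (f 0 + g 0 +_) (∑-+ n (f ∘ suc) (g ∘ suc)))
                        (interchange (f 0) (g 0) _ _)

∑-* : ∀ a n (f : ℕ → ℕ) → a * ∑ n f ≡ ∑ n (λ i → a * f i)
∑-* a zero    f = *-zeroʳ a
∑-* a (suc n) f = trans (*-distribˡ-+ a (f 0) _) (cong (a * f 0 +_) (∑-* a n (f ∘ suc)))

∑-0 : ∀ n → ∑ n (λ _ → 0) ≡ 0
∑-0 zero    = refl
∑-0 (suc n) = ∑-0 n

∑-swap : ∀ m n (f : ℕ → ℕ → ℕ) → ∑ m (λ i → ∑ n (f i)) ≡ ∑ n (λ j → ∑ m (λ i → f i j))
∑-swap zero    n f = sym (∑-0 n)
∑-swap (suc m) n f = trans (cong (∑ n (f 0) +_) (∑-swap m n (f ∘ suc))) (sym (∑-+ n (f 0) _))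

applyDownFrom≡applyUpTo : ∀ n (f : ℕ → ℕ) → applyDownFrom f n ≡ applyUpTo (λ i → f (n ∸ suc i)) n
applyDownFrom≡applyUpTo zero    f = refl
applyDownFrom≡applyUpTo (suc n) f = cong (f n ∷_) (applyDownFrom≡applyUpTo n f)

∑-reverse : ∀ n (f : ℕ → ℕ) → ∑ n f ≡ ∑ n (λ i → f (n ∸ suc i))
∑-reverse n f = begin
  sum (applyUpTo f n)            ≡⟨ sum-↭ (Perm.↭-reverse (applyUpTo f n)) ⟨
  sum (reverse (applyUpTo f n))  ≡⟨ cong sum (reverse-applyUpTo f n) ⟩
  sum (applyDownFrom f n)        ≡⟨ cong sum (applyDownFrom≡applyUpTo n f) ⟩
  ∑ n (λ i → f (n ∸ suc i))      ∎
  where open ≡-Reasoning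

Σ≡∑ : ∀ a b (f : ℕ → ℕ) → Σ[ a ⋯ b ] f ≡ ∑ (suc b ∸ a) (λ i → f (a + i))
Σ≡∑ a b f = cong sum (map-applyUpTo (a +_) f (suc b ∸ a))

∑ₗ-cong : (xs : List A) {f g : A → ℕ} → (∀ x → x ∈ xs → f x ≡ g x) → ∑ₗ xs f ≡ ∑ₗ xs g
∑ₗ-cong []       h = refl
∑ₗ-cong (x ∷ xs) h = cong₂ _+_ (h x (here refl)) (∑ₗ-cong xs (λ y y∈ → h y (there y∈)))

∑ₗ-0 : (xs : List A) → ∑ₗ xs (λ _ → 0) ≡ 0
∑ₗ-0 []       = refl
∑ₗ-0 (x ∷ xs) = ∑ₗ-0 xs

∑ₗ-++ : (xs ys : List A) (f : A → ℕ) → ∑ₗ (xs ++ ys) f ≡ ∑ₗ xs f + ∑ₗ ys f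
∑ₗ-++ xs ys f = trans (cong sum (map-++ f xs ys)) (sum-++ (map f xs) (map f ys))

∑ₗ-map : (g : A → B) (xs : List A) (f : B → ℕ) → ∑ₗ (map g xs) f ≡ ∑ₗ xs (f ∘ g)
∑ₗ-map g xs f = cong sum (sym (map-∘ xs))

∑ₗ-concatMap : (g : A → List B) (xs : List A) (f : B → ℕ) →
  ∑ₗ (concatMap g xs) f ≡ ∑ₗ xs (λ x → ∑ₗ (g x) f)
∑ₗ-concatMap g []       f = refl
∑ₗ-concatMap g (x ∷ xs) f =
  trans (∑ₗ-++ (g x) (concatMap g xs) f) (cong (∑ₗ (g x) f +_) (∑ₗ-concatMap g xs f))

∑ₗ-cartesianProductWith : (g : A → B → X) (xs : List A) (ys : List B) (f : X → ℕ) →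
  ∑ₗ (cartesianProductWith g xs ys) f ≡ ∑ₗ xs (λ x → ∑ₗ ys (λ y → f (g x y)))
∑ₗ-cartesianProductWith g []       ys f = refl
∑ₗ-cartesianProductWith g (x ∷ xs) ys f =
  trans (∑ₗ-++ (map (g x) ys) _ f)
        (cong₂ _+_ (∑ₗ-map (g x) ys f) (∑ₗ-cartesianProductWith g xs ys f))

∑ₗ-*ˡ : ∀ a (xs : List A) (f : A → ℕ) → ∑ₗ xs (λ x → a * f x) ≡ a * ∑ₗ xs f
∑ₗ-*ˡ a []       f = sym (*-zeroʳ a)
∑ₗ-*ˡ a (x ∷ xs) f = trans (cong (a * f x +_) (∑ₗ-*ˡ a xs f)) (sym (*-distribˡ-+ a (f x) _))

∑ₗ-*ʳ : ∀ a (xs : List A) (f : A → ℕ) → ∑ₗ xs (λ x → f x * a) ≡ ∑ₗ xs f * a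
∑ₗ-*ʳ a []       f = refl
∑ₗ-*ʳ a (x ∷ xs) f = trans (cong (f x * a +_) (∑ₗ-*ʳ a xs f)) (sym (*-distribʳ-+ a (f x) _))

∑ₗ-∑-swap : (xs : List A) (n : ℕ) (f : A → ℕ → ℕ) →
  ∑ₗ xs (λ x → ∑ n (f x)) ≡ ∑ n (λ i → ∑ₗ xs (λ x → f x i))
∑ₗ-∑-swap []       n f = sym (∑-0 n)
∑ₗ-∑-swap (x ∷ xs) n f = trans (cong (∑ n (f x) +_) (∑ₗ-∑-swap xs n f)) (sym (∑-+ n (f x) _))

∑ₗ-∑-product : (xs : List A) (ys : List B) (n : ℕ) (f : ℕ → A → ℕ) (g : ℕ → B → ℕ) →
  ∑ₗ xs (λ x → ∑ₗ ys (λ y → ∑ n (λ s → f s x * g s y))) ≡ ∑ n (λ s → ∑ₗ xs (f s) * ∑ₗ ys (g s))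
∑ₗ-∑-product xs ys n f g = begin
  ∑ₗ xs (λ x → ∑ₗ ys (λ y → ∑ n (λ s → f s x * g s y)))
    ≡⟨ ∑ₗ-cong xs (λ x _ → ∑ₗ-∑-swap ys n (λ y s → f s x * g s y)) ⟩
  ∑ₗ xs (λ x → ∑ n (λ s → ∑ₗ ys (λ y → f s x * g s y)))
    ≡⟨ ∑ₗ-∑-swap xs n (λ x s → ∑ₗ ys (λ y → f s x * g s y)) ⟩
  ∑ n (λ s → ∑ₗ xs (λ x → ∑ₗ ys (λ y → f s x * g s y)))
    ≡⟨ ∑-cong n (λ s _ → trans (∑ₗ-cong xs (λ x _ → ∑ₗ-*ˡ (f s x) ys (g s)))
                               (∑ₗ-*ʳ (∑ₗ ys (g s)) xs (f s))) ⟩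
  ∑ n (λ s → ∑ₗ xs (f s) * ∑ₗ ys (g s)) ∎
  where open ≡-Reasoning

∸-suc : ∀ {m n} → m < n → n ∸ m ≡ suc (n ∸ suc m)
∸-suc = +-∸-assoc 1

-- Summing over decreasing trees

data Tree (A : Set) : Set where
  leaf : Tree A
  node : Tree A → A → Tree A → Tree A

-- c(T, t)
hookCount : Tree A → ℕ → ℕ
hookCount leaf                      t = 1
hookCount (node l _ leaf)           t = hookCount l (suc t)
hookCount (node l _ r@(node _ _ _)) t = ∑ t (λ s → hookCount l (suc (t ∸ suc s)) * hookCount r s)

tailLength : Tree A → ℕ
tailLength leaf                    = 0
tailLength (node l _ leaf)         = suc (tailLength l)
tailLength (node _ _ (node _ _ _)) = 0

exactCount : ℕ → ℕ → Tree A → ℕ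
exactCount m t T = if does (tailLength T ≟ m) then hookCount T t else 0

splits : List A → List (List A × List A)
splits []       = [ [] , [] ]
splits (x ∷ xs) = map (λ (ys , zs) → x ∷ ys , zs) (splits xs)
               ++ map (λ (ys , zs) → ys , x ∷ zs) (splits xs)

splits-length : ∀ (xs : List A) {ys zs} → (ys , zs) ∈ splits xs → length ys + length zs ≡ length xs
splits-length []       (here refl) = refl
splits-length (x ∷ xs) p with ∈-++⁻ (map _ (splits xs)) p
... | inj₁ q with (ys , zs) , r , refl ← ∈-map⁻ _ q = cong suc (splits-length xs r)
... | inj₂ q with (ys , zs) , r , refl ← ∈-map⁻ _ q =
  trans (+-suc (length ys) (length zs)) (cong suc (splits-length xs r))

-- The head may join either half, which is Pascal's rule for the number of splits whose left half
-- has size b.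
∑-splits : ∀ (xs : List A) (g : ℕ → ℕ → ℕ) → let n = length xs in
  ∑ₗ (splits xs) (λ (ys , zs) → g (length ys) (length zs)) ≡ ∑ (suc n) (λ b → (n C b) * g b (n ∸ b))
∑-splits []       g = sym (+-identityʳ _)
∑-splits (x ∷ xs) g = begin
  ∑ₗ (splits (x ∷ xs)) (λ (ys , zs) → g (length ys) (length zs))
    ≡⟨ ∑ₗ-++ (map _ (splits xs)) _ _ ⟩
  _ ≡⟨ cong₂ _+_ (∑ₗ-map _ (splits xs) _) (∑ₗ-map _ (splits xs) _) ⟩
  _ ≡⟨ cong₂ _+_ (∑-splits xs (λ b c → g (suc b) c)) (∑-splits xs (λ b c → g b (suc c))) ⟩
  F + (1 * g 0 (suc n) + ∑ n (λ b → (n C suc b) * g (suc b) (suc (n ∸ suc b))))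
    ≡⟨ +-comm F _ ⟩
  1 * g 0 (suc n) + ∑ n (λ b → (n C suc b) * g (suc b) (suc (n ∸ suc b))) + F
    ≡⟨ +-assoc (1 * g 0 (suc n)) _ F ⟩
  1 * g 0 (suc n) + (∑ n (λ b → (n C suc b) * g (suc b) (suc (n ∸ suc b))) + F)
    ≡⟨ cong (1 * g 0 (suc n) +_) (trans (+-comm _ F) (cong (F +_) second)) ⟩
  1 * g 0 (suc n) + (F + ∑ (suc n) (λ b → (n C suc b) * g (suc b) (n ∸ b)))
    ≡⟨ cong (1 * g 0 (suc n) +_) (∑-+ (suc n) (λ b → (n C b) * g (suc b) (n ∸ b)) (λ b → (n C suc b) * g (suc b) (n ∸ b))) ⟨
  1 * g 0 (suc n) + ∑ (suc n) (λ b → (n C b) * g (suc b) (n ∸ b) + (n C suc b) * g (suc b) (n ∸ b))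
    ≡⟨ cong (1 * g 0 (suc n) +_) (∑-cong (suc n) (λ b _ → pascal b)) ⟩
  1 * g 0 (suc n) + ∑ (suc n) (λ b → (suc n C suc b) * g (suc b) (n ∸ b)) ∎
  where
  open ≡-Reasoning
  n = length xs
  F = ∑ (suc n) (λ b → (n C b) * g (suc b) (n ∸ b))
  pascal : ∀ b → (n C b) * g (suc b) (n ∸ b) + (n C suc b) * g (suc b) (n ∸ b)
                 ≡ (suc n C suc b) * g (suc b) (n ∸ b)
  pascal b = trans (sym (*-distribʳ-+ (g (suc b) (n ∸ b)) (n C b) (n C suc b)))
                   (cong (_* g (suc b) (n ∸ b)) (nCk+nC[k+1]≡[n+1]C[k+1] n b))
  -- Lets both sums run over the same range: the added term b = n vanishes because n C (n + 1) = 0.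
  second : ∑ n (λ b → (n C suc b) * g (suc b) (suc (n ∸ suc b)))
           ≡ ∑ (suc n) (λ b → (n C suc b) * g (suc b) (n ∸ b))
  second = begin
    ∑ n (λ b → (n C suc b) * g (suc b) (suc (n ∸ suc b)))
      ≡⟨ ∑-cong n (λ b b<n → cong (λ m → (n C suc b) * g (suc b) m) (sym (∸-suc b<n))) ⟩
    ∑ n (λ b → (n C suc b) * g (suc b) (n ∸ b))
      ≡⟨ +-identityʳ _ ⟨
    ∑ n (λ b → (n C suc b) * g (suc b) (n ∸ b)) + 0
      ≡⟨ cong (λ z → ∑ n (λ b → (n C suc b) * g (suc b) (n ∸ b)) + z * g (suc n) (n ∸ n))
              (k>n⇒nCk≡0 (n<1+n n)) ⟨
    ∑ n (λ b → (n C suc b) * g (suc b) (n ∸ b)) + (n C suc n) * g (suc n) (n ∸ n)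
      ≡⟨ ∑-∷ʳ n _ ⟨
    ∑ (suc n) (λ b → (n C suc b) * g (suc b) (n ∸ b)) ∎

-- Fuel: only the case where k bounds the length of the list is meaningful.
trees : ℕ → List A → List (Tree A)
trees zero    _        = [ leaf ]
trees (suc k) []       = [ leaf ]
trees (suc k) (x ∷ xs) = concatMap
  (λ (ys , zs) → cartesianProductWith (λ l r → node l x r) (trees k ys) (trees k zs)) (splits xs)

trees-[] : ∀ k → trees {A} k [] ≡ [ leaf ]
trees-[] zero    = refl
trees-[] (suc k) = refl

∈-trees-∷⁻ : ∀ k (x : A) xs {T} → T ∈ trees (suc k) (x ∷ xs) →
  ∃₂ λ ys zs → (ys , zs) ∈ splits xs × ∃₂ λ l r → l ∈ trees k ys × r ∈ trees k zs × T ≡ node l x r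
∈-trees-∷⁻ k x xs p
  with ws , p′ , q ← ∈-concat⁻′ (map _ (splits xs)) p
  with (ys , zs) , s , refl ← ∈-map⁻ _ q
  = ys , zs , s , ∈-cartesianProductWith⁻ _ (trees k ys) (trees k zs) p′

-- `p` accounts for the trees whose root has an empty right subtree, `q` for the others. The right
-- subtree is empty only for the split that puts all of `xs` on the left, so this is the single term
-- b = n of the binomial sum, with coefficient n C n = 1.
∑-trees-∷ : ∀ k (x : A) xs → length xs ≤ k → (F : Tree A → ℕ) (Q : Tree A → Tree A → ℕ)
  (p : ℕ → ℕ) (q : ℕ → ℕ → ℕ) →
  (∀ l r₁ y r₂ → F (node l x (node r₁ y r₂)) ≡ Q l (node r₁ y r₂)) →
  (∀ ys → length ys ≤ k → ∑ₗ (trees k ys) (λ l → F (node l x leaf)) ≡ p (length ys)) →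
  (∀ ys zs → length ys ≤ k → length zs ≤ k →
    ∑ₗ (trees k ys) (λ l → ∑ₗ (trees k zs) (Q l)) ≡ q (length ys) (length zs)) →
  let n = length xs in
  ∑ₗ (trees (suc k) (x ∷ xs)) F ≡ ∑ n (λ b → (n C b) * q b (n ∸ b)) + p n
∑-trees-∷ {A} k x xs n≤k F Q p q F≡Q F-leaf F-node = begin
  ∑ₗ (trees (suc k) (x ∷ xs)) F
    ≡⟨ ∑ₗ-concatMap _ (splits xs) F ⟩
  ∑ₗ (splits xs) (λ (ys , zs) → ∑ₗ (cartesianProductWith _ (trees k ys) (trees k zs)) F)
    ≡⟨ ∑ₗ-cong (splits xs) (λ (ys , zs) m →
         trans (∑ₗ-cartesianProductWith _ (trees k ys) (trees k zs) F)
               (inner ys zs (≤-trans (m+n≤o⇒m≤o (length ys) (≤-reflexive (splits-length xs m))) n≤k)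
                            (≤-trans (m+n≤o⇒n≤o (length ys) (≤-reflexive (splits-length xs m))) n≤k))) ⟩
  ∑ₗ (splits xs) (λ (ys , zs) → h (length ys) (length zs))
    ≡⟨ ∑-splits xs h ⟩
  ∑ (suc n) (λ b → (n C b) * h b (n ∸ b))
    ≡⟨ ∑-∷ʳ n _ ⟩
  ∑ n (λ b → (n C b) * h b (n ∸ b)) + (n C n) * h n (n ∸ n)
    ≡⟨ cong₂ _+_ (∑-cong n (λ b b<n → cong ((n C b) *_) (h-node b (n ∸ b) (m<n⇒0<n∸m b<n))))
                 (trans (cong₂ _*_ (nCn≡1 n) (cong (h n) (n∸n≡0 n))) (*-identityˡ (p n))) ⟩
  ∑ n (λ b → (n C b) * q b (n ∸ b)) + p n ∎
  where
  open ≡-Reasoning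
  n = length xs
  h : ℕ → ℕ → ℕ
  h b zero      = p b
  h b c@(suc _) = q b c
  h-node : ∀ b c → 0 < c → h b c ≡ q b c
  h-node b (suc c) _ = refl
  F-r : ∀ k′ z zs {r} → r ∈ trees (suc k′) (z ∷ zs) → ∀ l → F (node l x r) ≡ Q l r
  F-r k′ z zs r∈ l with _ , _ , _ , r₁ , r₂ , _ , _ , refl ← ∈-trees-∷⁻ k′ z zs r∈ = F≡Q l r₁ z r₂
  inner : ∀ ys zs → length ys ≤ k → length zs ≤ k →
    ∑ₗ (trees k ys) (λ l → ∑ₗ (trees k zs) (λ r → F (node l x r))) ≡ h (length ys) (length zs)
  inner ys [] ys≤ _ rewrite trees-[] {A} k =
    trans (∑ₗ-cong (trees k ys) (λ l _ → +-identityʳ _)) (F-leaf ys ys≤)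
  inner ys (z ∷ zs) ys≤ zs≤@(s≤s {n = k′} _) =
    trans (∑ₗ-cong (trees k ys) (λ l _ → ∑ₗ-cong (trees k (z ∷ zs)) (λ r r∈ → F-r k′ z zs r∈ l)))
          (F-node ys (z ∷ zs) ys≤ zs≤)

-- The formula for c at a descent top, summed over left subtrees with b labels and right subtrees
-- with c labels, where `g` gives the sum for each size.
splitSum : (ℕ → ℕ → ℕ) → ℕ → ℕ → ℕ → ℕ
splitSum g t b c = ∑ t (λ s → g b (suc (t ∸ suc s)) * g c s)

-- The sum of c(T, t) over the decreasing trees with n ≤ k labels; exactTotal
-- restricts it to tail length m.
total : ℕ → ℕ → ℕ → ℕ
total zero    _       t = 1
total (suc k) zero    t = 1
total (suc k) (suc n) t = ∑ n (λ b → (n C b) * splitSum (total k) t b (n ∸ b)) + total k n (suc t)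

exactTotal : ℕ → ℕ → ℕ → ℕ → ℕ
exactTotal k       zero    zero    t = 1
exactTotal k       zero    (suc m) t = 0
exactTotal zero    (suc n) m       t = 0
exactTotal (suc k) (suc n) zero    t = ∑ n (λ b → (n C b) * splitSum (total k) t b (n ∸ b))
exactTotal (suc k) (suc n) (suc m) t = exactTotal k n m (suc t)

∑-hookCount : ∀ k (xs : List A) → length xs ≤ k → ∀ t → ∑ₗ (trees k xs) (λ T → hookCount T t) ≡ total k (length xs) t

∑∑-hookCount : ∀ k (ys zs : List A) → length ys ≤ k → length zs ≤ k → ∀ t →
  ∑ₗ (trees k ys) (λ l → ∑ₗ (trees k zs) (λ r → ∑ t (λ s → hookCount l (suc (t ∸ suc s)) * hookCount r s)))
  ≡ splitSum (total k) t (length ys) (length zs)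
∑∑-hookCount k ys zs ys≤ zs≤ t =
  trans (∑ₗ-∑-product (trees k ys) (trees k zs) t (λ s l → hookCount l (suc (t ∸ suc s))) (λ s r → hookCount r s))
        (∑-cong t (λ s _ → cong₂ _*_ (∑-hookCount k ys ys≤ _) (∑-hookCount k zs zs≤ s)))

∑-hookCount zero    []       _ t = refl
∑-hookCount (suc k) []       _ t = refl
∑-hookCount (suc k) (x ∷ xs) (s≤s n≤k) t =
  ∑-trees-∷ k x xs n≤k (λ T → hookCount T t) _ (λ b → total k b (suc t)) (splitSum (total k) t)
    (λ _ _ _ _ → refl)
    (λ ys ys≤ → ∑-hookCount k ys ys≤ (suc t))
    (λ ys zs ys≤ zs≤ → ∑∑-hookCount k ys zs ys≤ zs≤ t)

-- A nonempty tree has tail length 0 exactly when its right subtree is nonempty, so in each case one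
-- of the two parts of `∑-trees-∷` vanishes. A positive tail length drops by one in the left
-- subtree, where the root counts as one more larger value.
∑-exactCount : ∀ k (xs : List A) → length xs ≤ k → ∀ m t → ∑ₗ (trees k xs) (exactCount m t) ≡ exactTotal k (length xs) m t
∑-exactCount zero    []       _ zero    t = refl
∑-exactCount zero    []       _ (suc m) t = refl
∑-exactCount (suc k) []       _ zero    t = refl
∑-exactCount (suc k) []       _ (suc m) t = refl
∑-exactCount (suc k) (x ∷ xs) (s≤s n≤k) zero t = trans
  (∑-trees-∷ k x xs n≤k (exactCount 0 t) _ (λ _ → 0) (splitSum (total k) t)
    (λ _ _ _ _ → refl)
    (λ ys _ → ∑ₗ-0 (trees k ys))
    (λ ys zs ys≤ zs≤ → ∑∑-hookCount k ys zs ys≤ zs≤ t))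
  (+-identityʳ _)
∑-exactCount (suc k) (x ∷ xs) (s≤s n≤k) (suc m) t = trans
  (∑-trees-∷ k x xs n≤k (exactCount (suc m) t) (λ _ _ → 0) (λ b → exactTotal k b m (suc t)) (λ _ _ → 0)
    (λ _ _ _ _ → refl)
    (λ ys ys≤ → ∑-exactCount k ys ys≤ m (suc t))
    (λ ys zs _ _ → trans (∑ₗ-cong (trees k ys) (λ _ _ → ∑ₗ-0 (trees k zs))) (∑ₗ-0 (trees k ys))))
  (cong (_+ exactTotal k (length xs) m (suc t))
    (trans (∑-cong (length xs) (λ b _ → *-zeroʳ (length xs C b))) (∑-0 (length xs))))

total-fuel : ∀ {k k′ n} → n ≤ k → n ≤ k′ → ∀ t → total k n t ≡ total k′ n t
total-fuel {zero}  {zero}   z≤n _ t = refl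
total-fuel {zero}  {suc k′} z≤n _ t = refl
total-fuel {suc k} {zero}   z≤n _ t = refl
total-fuel {suc k} {suc k′} {zero} _ _ t = refl
total-fuel {suc k} {suc k′} {suc n} (s≤s n≤k) (s≤s n≤k′) t = cong₂ _+_
  (∑-cong n (λ b b<n → cong ((n C b) *_) (∑-cong t (λ s _ → cong₂ _*_
    (total-fuel (≤-trans (<⇒≤ b<n) n≤k) (≤-trans (<⇒≤ b<n) n≤k′) _)
    (total-fuel (≤-trans (m∸n≤m n b) n≤k) (≤-trans (m∸n≤m n b) n≤k′) s)))))
  (total-fuel n≤k n≤k′ (suc t))

-- Positive tail length forces an empty right subtree, so the m largest letters leave the word one
-- after another and join the larger values.
exactTotal-peel : ∀ m k n j t → exactTotal (m + k) (m + n) (m + j) t ≡ exactTotal k n j (m + t)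
exactTotal-peel zero    k n j t = refl
exactTotal-peel (suc m) k n j t = trans (exactTotal-peel m k n j (suc t)) (cong (exactTotal k n j) (+-suc m t))

-- The term m = 0 collects the trees whose root has a right subtree; the other terms are the same
-- sum for the left subtree of a root without one.
∑-exactTotal : ∀ {k n} → n ≤ k → ∀ t → ∑ (suc n) (λ m → exactTotal k n m t) ≡ total k n t
∑-exactTotal {zero}  {zero}  _ t = refl
∑-exactTotal {suc k} {zero}  _ t = refl
∑-exactTotal {suc k} {suc n} (s≤s n≤k) t = cong (exactTotal (suc k) (suc n) 0 t +_) (∑-exactTotal n≤k (suc t))

-- The recurrence, derived from the tree totals alone

recurrence : (d : ℕ → ℕ → ℕ) → (∀ m n → d m n ≡ exactTotal n n m 0) →
  let d≥ = λ m n → Σ[ m ⋯ n ] (λ ℓ → d ℓ n) in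
  (∀ (m n : ℕ) → m < n →
      d m n ≡ Σ[ 1 ⋯ m ] (λ j → Σ[ 1 ⋯ n ∸ m ∸ 1 ] (λ i →
        ((n ∸ m ∸ 1) C (i ∸ 1)) * d≥ j (i + j ∸ 1) * d≥ (m ∸ j) (n ∸ j ∸ i))))
    × (∀ (n : ℕ) → 1 ≤ n → d n n ≡ 1)
recurrence d d≡exactTotal = rec , λ n _ → trans (d≡exactTotal n n) (diagonal n)
  where
  d≥ : ℕ → ℕ → ℕ
  d≥ m n = Σ[ m ⋯ n ] (λ ℓ → d ℓ n)

  diagonal : ∀ n → exactTotal n n n 0 ≡ 1
  diagonal n with h ← exactTotal-peel n 0 0 0 0 rewrite +-identityʳ n = h

  -- Tail length j + i in a word of length j + k means that the top j letters can be peeled off and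
  -- tail length i remains. The sum over i then puts no restriction on the remaining k letters.
  d≥≡total : ∀ j k → d≥ j (j + k) ≡ total k k j
  d≥≡total j k = begin
    d≥ j (j + k)
      ≡⟨ Σ≡∑ j (j + k) (λ ℓ → d ℓ (j + k)) ⟩
    ∑ (suc (j + k) ∸ j) (λ i → d (j + i) (j + k))
      ≡⟨ cong (λ z → ∑ z (λ i → d (j + i) (j + k)))
              (trans (cong (_∸ j) (sym (+-suc j k))) (m+n∸m≡n j (suc k))) ⟩
    ∑ (suc k) (λ i → d (j + i) (j + k))
      ≡⟨ ∑-cong (suc k) (λ i _ → trans (d≡exactTotal (j + i) (j + k)) (exactTotal-peel j k k i 0)) ⟩
    ∑ (suc k) (λ i → exactTotal k k i (j + 0))
      ≡⟨ ∑-exactTotal (≤-refl {k}) (j + 0) ⟩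
    total k k (j + 0)
      ≡⟨ cong (total k k) (+-identityʳ j) ⟩
    total k k j ∎
    where open ≡-Reasoning

  -- The length in the second factor: what remains consists of the larger values kept for the right
  -- subtree and its N - b labels.
  shrink : ∀ m N j b → j < m → b < N → m + suc N ∸ suc j ∸ suc b ≡ (m ∸ suc j) + (N ∸ b)
  shrink m N j b j<m b<N = begin
    m + suc N ∸ suc j ∸ suc b      ≡⟨ cong (_∸ suc b) (+-∸-comm (suc N) j<m) ⟩
    (m ∸ suc j) + suc N ∸ suc b    ≡⟨ +-∸-assoc (m ∸ suc j) {suc N} {suc b} (s≤s (<⇒≤ b<N)) ⟩
    (m ∸ suc j) + (N ∸ b)          ∎
    where open ≡-Reasoning

  term : ∀ m N b s → s < m → b < N →
    (N C b) * (total N b (suc s) * total N (N ∸ b) (m ∸ suc s))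
    ≡ (N C b) * d≥ (suc s) (suc b + suc s ∸ 1) * d≥ (m ∸ suc s) (m + suc N ∸ suc s ∸ suc b)
  term m N b s s<m b<N = begin
    (N C b) * (total N b (suc s) * total N (N ∸ b) (m ∸ suc s))
      ≡⟨ *-assoc (N C b) _ _ ⟨
    (N C b) * total N b (suc s) * total N (N ∸ b) (m ∸ suc s)
      ≡⟨ cong₂ (λ y z → (N C b) * y * z)
           (trans (total-fuel (<⇒≤ b<N) ≤-refl (suc s)) (sym (d≥≡total (suc s) b)))
           (trans (total-fuel (m∸n≤m N b) ≤-refl (m ∸ suc s)) (sym (d≥≡total (m ∸ suc s) (N ∸ b)))) ⟩
    (N C b) * d≥ (suc s) (suc s + b) * d≥ (m ∸ suc s) ((m ∸ suc s) + (N ∸ b))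
      ≡⟨ cong₂ (λ y z → (N C b) * d≥ (suc s) y * d≥ (m ∸ suc s) z)
           (+-comm (suc s) b) (sym (shrink m N s b s<m b<N)) ⟩
    (N C b) * d≥ (suc s) (b + suc s) * d≥ (m ∸ suc s) (m + suc N ∸ suc s ∸ suc b) ∎
    where open ≡-Reasoning

  summand : ℕ → ℕ → ℕ → ℕ → ℕ → ℕ
  summand m n N j i = (N C (i ∸ 1)) * d≥ j (i + j ∸ 1) * d≥ (m ∸ j) (n ∸ j ∸ i)

  rec′ : ∀ m N → d m (m + suc N) ≡ Σ[ 1 ⋯ m ] (λ j → Σ[ 1 ⋯ N ] (summand m (m + suc N) N j))
  rec′ m N = begin
    d m (m + suc N)
      ≡⟨ d≡exactTotal m (m + suc N) ⟩
    exactTotal (m + suc N) (m + suc N) m 0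
      ≡⟨ cong (λ z → exactTotal (m + suc N) (m + suc N) z 0) (+-identityʳ m) ⟨
    exactTotal (m + suc N) (m + suc N) (m + 0) 0
      ≡⟨ exactTotal-peel m (suc N) (suc N) 0 0 ⟩
    exactTotal (suc N) (suc N) 0 (m + 0)
      ≡⟨ cong (exactTotal (suc N) (suc N) 0) (+-identityʳ m) ⟩
    ∑ N (λ b → (N C b) * splitSum (total N) m b (N ∸ b))
      ≡⟨ ∑-cong N inner ⟩
    ∑ N (λ b → ∑ m (λ s → f (suc s) (suc b)))
      ≡⟨ ∑-swap N m (λ b s → f (suc s) (suc b)) ⟩
    ∑ m (λ s → ∑ N (λ b → f (suc s) (suc b)))
      ≡⟨ ∑-cong m (λ s _ → Σ≡∑ 1 N (f (suc s))) ⟨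
    ∑ m (λ s → Σ[ 1 ⋯ N ] (f (suc s)))
      ≡⟨ Σ≡∑ 1 m (λ j → Σ[ 1 ⋯ N ] (f j)) ⟨
    Σ[ 1 ⋯ m ] (λ j → Σ[ 1 ⋯ N ] (f j)) ∎
    where
    open ≡-Reasoning
    unreverse : ∀ {s} → s < m → suc (m ∸ suc (m ∸ suc s)) ≡ suc s
    unreverse {s} s<m = begin
      suc (m ∸ suc (m ∸ suc s))  ≡⟨ cong (λ z → suc (m ∸ z)) (sym (∸-suc s<m)) ⟩
      suc (m ∸ (m ∸ s))          ≡⟨ cong suc (m∸[m∸n]≡n (<⇒≤ s<m)) ⟩
      suc s                      ∎
    f : ℕ → ℕ → ℕ
    f = summand m (m + suc N) N
    g : ℕ → ℕ → ℕ
    g b s = total N b (suc (m ∸ suc s)) * total N (N ∸ b) s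
    inner : ∀ b → b < N → (N C b) * ∑ m (g b) ≡ ∑ m (λ s → f (suc s) (suc b))
    inner b b<N = begin
      (N C b) * ∑ m (g b)
        -- The tree formula is indexed by the number s of larger values before the endpoint of the
        -- root's hook, the recurrence by the number j = m - s of values open to the left subtree;
        -- hence the reversal.
        ≡⟨ cong ((N C b) *_) (∑-reverse m (g b)) ⟩
      (N C b) * ∑ m (λ s → g b (m ∸ suc s))
        ≡⟨ ∑-* (N C b) m (λ s → g b (m ∸ suc s)) ⟩
      ∑ m (λ s → (N C b) * g b (m ∸ suc s))
        ≡⟨ ∑-cong m (λ s s<m → trans
             (cong (λ z → (N C b) * (total N b z * total N (N ∸ b) (m ∸ suc s))) (unreverse s<m))
             (term m N b s s<m b<N)) ⟩
      ∑ m (λ s → f (suc s) (suc b)) ∎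

  rec : ∀ (m n : ℕ) → m < n →
      d m n ≡ Σ[ 1 ⋯ m ] (λ j → Σ[ 1 ⋯ n ∸ m ∸ 1 ] (λ i →
        ((n ∸ m ∸ 1) C (i ∸ 1)) * d≥ j (i + j ∸ 1) * d≥ (m ∸ j) (n ∸ j ∸ i)))
  rec m n m<n with rec′ m (n ∸ suc m)
  ... | h rewrite trans (+-suc m (n ∸ suc m)) (m+[n∸m]≡n m<n)
                | trans (∸-+-assoc n m 1) (cong (n ∸_) (+-comm m 1)) = h

-- Words as flattened trees

flatten : Tree A → List A
flatten leaf         = []
flatten (node l x r) = flatten l ++ x ∷ flatten r

AllPairs-∈ : {R : Rel A 0ℓ} {xs : List A} → AllPairs R xs →
  AllPairs (λ x y → x ∈ xs × y ∈ xs × R x y) xs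
AllPairs-∈ []         = []
AllPairs-∈ (px ∷ pxs) =
  All.tabulate (λ y∈ → here refl , there y∈ , All.lookup px y∈)
  ∷ AllPairs.map (λ (x∈ , y∈ , r) → there x∈ , there y∈ , r) (AllPairs-∈ pxs)

-- Injectivity in the first argument is asked only on `xs`, because concatenations can be cut apart
-- only with knowledge of their left parts: that they avoid a separator, or that they all have the
-- same length.
unique-cartesianProductWith : (f : A → B → X) {xs : List A} {ys : List B} →
  (∀ x {y y′} → f x y ≡ f x y′ → y ≡ y′) →
  (∀ {x x′ y y′} → x ∈ xs → x′ ∈ xs → f x y ≡ f x′ y′ → x ≡ x′) →
  Unique xs → Unique ys → Unique (cartesianProductWith f xs ys)
unique-cartesianProductWith f             injʳ injˡ []          ys! = []
unique-cartesianProductWith f {x ∷ xs} {ys} injʳ injˡ (x∉ ∷ xs!) ys! =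
  Unique.++⁺ (Unique.map⁺ (injʳ x) ys!)
    (unique-cartesianProductWith f injʳ (λ p q → injˡ (there p) (there q)) xs! ys!)
    disjoint
  where
  disjoint : Disjoint (map (f x) ys) (cartesianProductWith f xs ys)
  disjoint (p , q)
    with y , _ , refl ← ∈-map⁻ (f x) p
    with x′ , y′ , x′∈ , _ , eq ← ∈-cartesianProductWith⁻ f xs ys q
    = All.lookup x∉ x′∈ (injˡ (here refl) (there x′∈) eq)

unique-concatMap : (f : A → List B) {xs : List A} → (∀ {x} → x ∈ xs → Unique (f x)) →
  AllPairs (λ x y → Disjoint (f x) (f y)) xs → Unique (concatMap f xs)
unique-concatMap f u d = Unique.concat⁺ (All.map⁺ (All.tabulate u)) (AllPairs.map⁺ d)

∈-remove : ∀ {x y : A} us {vs} → y ≢ x → y ∈ us ++ x ∷ vs → y ∈ us ++ vs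
∈-remove us y≢x y∈ with ∈-++⁻ us y∈
... | inj₁ p           = ∈-++⁺ˡ p
... | inj₂ (here refl) = contradiction refl y≢x
... | inj₂ (there p)   = ∈-++⁺ʳ us p

unique-⊆⇒↭ : ∀ {xs ys : List A} → Unique xs → xs ⊆ ys → length ys ≤ length xs → xs ↭ ys
unique-⊆⇒↭ {xs = []}     {[]}    _ _ _ = ↭-refl
unique-⊆⇒↭ {xs = x ∷ xs} (x∉ ∷ xs!) sub len with us , vs , refl ← ∈-∃++ (sub (here refl)) =
  ↭-trans (↭-prep x (unique-⊆⇒↭ xs!
      (λ y∈ → ∈-remove us (λ y≡x → All.lookup x∉ y∈ (sym y≡x)) (sub (there y∈)))
      (s≤s⁻¹ (≤-trans (≤-reflexive (sym (Perm.↭-length (Perm.shift x us vs)))) len))))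
    (↭-sym (Perm.shift x us vs))

unique-⊆⇒length≤ : ∀ {xs ys : List A} → Unique xs → xs ⊆ ys → length xs ≤ length ys
unique-⊆⇒length≤ {xs = []}     _ _ = z≤n
unique-⊆⇒length≤ {xs = x ∷ xs} (x∉ ∷ xs!) sub with us , vs , refl ← ∈-∃++ (sub (here refl)) =
  ≤-trans (s≤s (unique-⊆⇒length≤ xs!
      (λ y∈ → ∈-remove us (λ y≡x → All.lookup x∉ y∈ (sym y≡x)) (sub (there y∈)))))
    (≤-reflexive (sym (Perm.↭-length (Perm.shift x us vs))))

unique-⊆⊇⇒↭ : ∀ {xs ys : List A} → Unique xs → Unique ys → xs ⊆ ys → ys ⊆ xs → xs ↭ ys
unique-⊆⊇⇒↭ xs! ys! xs⊆ys ys⊆xs = unique-⊆⇒↭ xs! xs⊆ys (unique-⊆⇒length≤ ys! ys⊆xs)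

∑ₗ-↭ : {xs ys : List A} (f : A → ℕ) → xs ↭ ys → ∑ₗ xs f ≡ ∑ₗ ys f
∑ₗ-↭ f p = sum-↭ (Perm.map⁺ f p)

-- Stands in for an explicit bijection: each entry of `xs` is paired with an entry of `ys` that has
-- the same key, the pair contributes equally, and both are removed.
∑ₗ-match : (h : A → X) (k : B → X) (f : A → ℕ) (g : B → ℕ) (xs : List A) (ys : List B) →
  map h xs ↭ map k ys → (∀ {x y} → x ∈ xs → y ∈ ys → h x ≡ k y → f x ≡ g y) →
  ∑ₗ xs f ≡ ∑ₗ ys g
∑ₗ-match h k f g []       []       p eq = refl
∑ₗ-match h k f g []       (y ∷ ys) p eq = contradiction (↭-sym p) Perm.¬x∷xs↭[]
∑ₗ-match h k f g (x ∷ xs) ys       p eq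
  with y , y∈ , hx≡ky ← ∈-map⁻ k (Perm.∈-resp-↭ p (here refl))
  with us , vs , refl ← ∈-∃++ y∈
  = trans (cong₂ _+_ (eq (here refl) y∈ hx≡ky)
      (∑ₗ-match h k f g xs (us ++ vs)
        (subst (map h xs ↭_) (sym (map-++ k us vs)) (Perm.drop-mid [] (map k us)
          (subst₂ (λ a b → a ∷ map h xs ↭ b) hx≡ky (map-++ k us (y ∷ vs)) p)))
        (λ x∈ z∈ → eq (there x∈) (Perm.∈-resp-↭ (↭-sym (Perm.shift y us vs)) (there z∈)))))
    (sym (∑ₗ-↭ g (Perm.shift y us vs)))

splits-↭ : ∀ (xs : List A) {ys zs} → (ys , zs) ∈ splits xs → ys ++ zs ↭ xs
splits-↭ []       (here refl) = ↭-refl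
splits-↭ (x ∷ xs) p with ∈-++⁻ (map _ (splits xs)) p
... | inj₁ q with (ys , zs) , r , refl ← ∈-map⁻ _ q = ↭-prep x (splits-↭ xs r)
... | inj₂ q with (ys , zs) , r , refl ← ∈-map⁻ _ q =
  ↭-trans (Perm.shift x ys zs) (↭-prep x (splits-↭ xs r))

splits-⊆ˡ : ∀ (xs : List A) {ys zs} → (ys , zs) ∈ splits xs → ys ⊆ xs
splits-⊆ˡ xs s y∈ = Perm.∈-resp-↭ (splits-↭ xs s) (∈-++⁺ˡ y∈)

splits-⊆ʳ : ∀ (xs : List A) {ys zs} → (ys , zs) ∈ splits xs → zs ⊆ xs
splits-⊆ʳ xs {ys} s z∈ = Perm.∈-resp-↭ (splits-↭ xs s) (∈-++⁺ʳ ys z∈)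

-- The halves agree only up to rearrangement, since a split keeps the order of `xs` while the
-- letters of a word come in any order.
splits-complete : ∀ (xs us vs : List A) → us ++ vs ↭ xs →
  ∃₂ λ ys zs → (ys , zs) ∈ splits xs × us ↭ ys × vs ↭ zs
splits-complete []       []       []       p = [] , [] , here refl , ↭-refl , ↭-refl
splits-complete []       []       (v ∷ vs) p = contradiction p Perm.¬x∷xs↭[]
splits-complete []       (u ∷ us) vs       p = contradiction p Perm.¬x∷xs↭[]
splits-complete (x ∷ xs) us       vs       p
  with ∈-++⁻ us (Perm.∈-resp-↭ (↭-sym p) (here refl))
... | inj₁ x∈us
  with us₁ , us₂ , refl ← ∈-∃++ x∈us
  with ys , zs , s , a , b ← splits-complete xs (us₁ ++ us₂) vs
         (Perm.drop-∷ (↭-trans (↭-sym (Perm.++⁺ʳ vs (Perm.shift x us₁ us₂))) p))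
  = x ∷ ys , zs , ∈-++⁺ˡ (∈-map⁺ _ s) , ↭-trans (Perm.shift x us₁ us₂) (↭-prep x a) , b
... | inj₂ x∈vs
  with vs₁ , vs₂ , refl ← ∈-∃++ x∈vs
  with ys , zs , s , a , b ← splits-complete xs us (vs₁ ++ vs₂)
         (Perm.drop-∷ (↭-trans (↭-sym (Perm.shift x us (vs₁ ++ vs₂)))
                      (↭-trans (↭-sym (Perm.++⁺ˡ us (Perm.shift x vs₁ vs₂))) p)))
  = ys , x ∷ zs , ∈-++⁺ʳ (map _ (splits xs)) (∈-map⁺ _ s) , a , ↭-trans (Perm.shift x vs₁ vs₂) (↭-prep x b)

splits-AllPairs : {R : Rel A 0ℓ} (xs : List A) {ys zs : List A} → (ys , zs) ∈ splits xs →
  AllPairs R xs → AllPairs R ys × AllPairs R zs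
splits-AllPairs []       (here refl) [] = [] , []
splits-AllPairs (x ∷ xs) p (rx ∷ rxs) with ∈-++⁻ (map _ (splits xs)) p
... | inj₁ q with _ , s , refl ← ∈-map⁻ _ q with a , b ← splits-AllPairs xs s rxs =
  All.anti-mono (splits-⊆ˡ xs s) rx ∷ a , b
... | inj₂ q with _ , s , refl ← ∈-map⁻ _ q with a , b ← splits-AllPairs xs s rxs =
  a , All.anti-mono (splits-⊆ʳ xs s) rx ∷ b

splits-[]ʳ : ∀ (xs : List A) {ys} → (ys , []) ∈ splits xs → ys ≡ xs
splits-[]ʳ []       (here refl) = refl
splits-[]ʳ (x ∷ xs) p with ∈-++⁻ (map _ (splits xs)) p
... | inj₁ q with _ , s , refl ← ∈-map⁻ _ q = cong (x ∷_) (splits-[]ʳ xs s)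
... | inj₂ q with _ , _ , () ← ∈-map⁻ _ q

-- Distinctness of splits is recorded by membership, which survives the rearrangement of a half into
-- a word.
Separated : List A → List A → Set
Separated ys ys′ = ∃ λ z → (z ∈ ys × z ∉ ys′) ⊎ (z ∉ ys × z ∈ ys′)

splits-separated : (xs : List A) → Unique xs →
  AllPairs (λ (ys , _) (ys′ , _) → Separated ys ys′) (splits xs)
splits-separated []       _            = [] ∷ []
splits-separated (x ∷ xs) xs!@(x∉ ∷ tail!) = AllPairs.++⁺
  (AllPairs.map⁺ (AllPairs.map (λ (s , s′ , sep) → prepend s s′ sep) (AllPairs-∈ ih)))
  (AllPairs.map⁺ ih)
  (All.tabulate λ p → All.tabulate λ q → cross p q)
  where
  ih = splits-separated xs tail!
  x∉xs : x ∉ xs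
  x∉xs = Unique.Unique[x∷xs]⇒x∉xs xs!
  ∈-behead : ∀ {ys z} → z ∈ xs → z ∈ x ∷ ys → z ∈ ys
  ∈-behead z∈ (here refl) = contradiction z∈ x∉xs
  ∈-behead z∈ (there p)   = p
  prepend : ∀ {ys zs ys′ zs′} → (ys , zs) ∈ splits xs → (ys′ , zs′) ∈ splits xs →
    Separated ys ys′ → Separated (x ∷ ys) (x ∷ ys′)
  prepend s s′ (z , inj₁ (p , q)) = z , inj₁ (there p , q ∘ ∈-behead (splits-⊆ˡ xs s p))
  prepend s s′ (z , inj₂ (p , q)) = z , inj₂ (p ∘ ∈-behead (splits-⊆ˡ xs s′ q) , there q)
  cross : ∀ {a b} → a ∈ map (λ (ys , zs) → x ∷ ys , zs) (splits xs) →
                    b ∈ map (λ (ys , zs) → ys , x ∷ zs) (splits xs) → Separated (proj₁ a) (proj₁ b)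
  cross p q with _ , s , refl ← ∈-map⁻ _ p with _ , s′ , refl ← ∈-map⁻ _ q
    = x , inj₁ (here refl , x∉xs ∘ splits-⊆ˡ xs s′)

splits-length≤ : ∀ (xs : List A) {ys zs k} → (ys , zs) ∈ splits xs → length xs ≤ k →
  length ys ≤ k × length zs ≤ k
splits-length≤ xs {ys} s n≤k =
    ≤-trans (m+n≤o⇒m≤o (length ys) (≤-reflexive (splits-length xs s))) n≤k
  , ≤-trans (m+n≤o⇒n≤o (length ys) (≤-reflexive (splits-length xs s))) n≤k

trees-sound : ∀ k (xs : List A) {T} → length xs ≤ k → T ∈ trees k xs → flatten T ↭ xs
trees-sound zero    []       _         (here refl) = ↭-refl
trees-sound (suc k) []       _         (here refl) = ↭-refl
trees-sound (suc k) (x ∷ xs) (s≤s n≤k) T∈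
  with ys , zs , s , l , r , l∈ , r∈ , refl ← ∈-trees-∷⁻ k x xs T∈
  with ys≤ , zs≤ ← splits-length≤ xs s n≤k
  = ↭-trans (Perm.shift x (flatten l) (flatten r))
      (↭-prep x (↭-trans (Perm.++⁺ (trees-sound k ys ys≤ l∈) (trees-sound k zs zs≤ r∈)) (splits-↭ xs s)))

-- The head `x` is the root, and its place in the word divides the other letters into the two
-- subtrees; each side is a rearrangement of one half of a split.
trees-complete : ∀ k (xs : List A) {w} → length xs ≤ k → w ↭ xs → w ∈ map flatten (trees k xs)
trees-complete zero    []       _ p with refl ← Perm.↭-empty-inv p = here refl
trees-complete (suc k) []       _ p with refl ← Perm.↭-empty-inv p = here refl
trees-complete (suc k) (x ∷ xs) (s≤s n≤k) p
  with u , v , refl ← ∈-∃++ (Perm.∈-resp-↭ (↭-sym p) (here refl))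
  with ys , zs , s , a , b ← splits-complete xs u v (Perm.drop-mid u [] p)
  with ys≤ , zs≤ ← splits-length≤ xs s n≤k
  with l , l∈ , refl ← ∈-map⁻ flatten (trees-complete k ys ys≤ a)
  with r , r∈ , refl ← ∈-map⁻ flatten (trees-complete k zs zs≤ b)
  = ∈-map⁺ flatten (∈-concat⁺′ (∈-cartesianProductWith⁺ _ l∈ r∈) (∈-map⁺ _ s))

-- Since neither prefix contains `x`, the first `x` marks the cut.
split-at-injective : ∀ {x : A} u u′ {v v′} → x ∉ u → x ∉ u′ → u ++ x ∷ v ≡ u′ ++ x ∷ v′ → u ≡ u′
split-at-injective []      []        _  _   _  = refl
split-at-injective []      (_ ∷ _)   _  x∉′ eq = contradiction (here (proj₁ (∷-injective eq))) x∉′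
split-at-injective (_ ∷ _) []        x∉ _   eq = contradiction (here (sym (proj₁ (∷-injective eq)))) x∉
split-at-injective (y ∷ u) (y′ ∷ u′) x∉ x∉′ eq with refl , eq′ ← ∷-injective eq =
  cong (y ∷_) (split-at-injective u u′ (x∉ ∘ there) (x∉′ ∘ there) eq′)

map-cartesianProductWith : (h : X → B) (f : A → A → X) (g : B → B → B) (h′ : A → B) →
  (∀ a b → h (f a b) ≡ g (h′ a) (h′ b)) → ∀ xs ys →
  map h (cartesianProductWith f xs ys) ≡ cartesianProductWith g (map h′ xs) (map h′ ys)
map-cartesianProductWith h f g h′ eq []       ys = refl
map-cartesianProductWith h f g h′ eq (x ∷ xs) ys = begin
  map h (map (f x) ys ++ cartesianProductWith f xs ys)
    ≡⟨ map-++ h (map (f x) ys) _ ⟩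
  map h (map (f x) ys) ++ map h (cartesianProductWith f xs ys)
    ≡⟨ cong₂ _++_ (trans (sym (map-∘ ys)) (trans (map-cong (eq x) ys) (map-∘ ys)))
                  (map-cartesianProductWith h f g h′ eq xs ys) ⟩
  map (g (h′ x)) (map h′ ys) ++ cartesianProductWith g (map h′ xs) (map h′ ys) ∎
  where open ≡-Reasoning

-- The root occurs once in a word, so it determines the left and right parts. Words from one split
-- differ in these parts; words from different splits differ in a letter that is left of the root in
-- only one of them.
trees-unique : ∀ k (xs : List A) → length xs ≤ k → Unique xs → Unique (map flatten (trees k xs))
trees-unique zero    []       _         _   = [] ∷ []
trees-unique (suc k) []       _         _   = [] ∷ []
trees-unique {A} (suc k) (x ∷ xs) (s≤s n≤k) xs!@(_ ∷ tail!) =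
  subst Unique (sym words≡)
    (unique-concatMap words block-unique
      (AllPairs.map (λ (s , s′ , sep) {w} → block-disjoint s s′ sep {w}) (AllPairs-∈ (splits-separated xs tail!))))
  where
  join : List A → List A → List A
  join u v = u ++ x ∷ v
  words : List A × List A → List (List A)
  words (ys , zs) = cartesianProductWith join (map flatten (trees k ys)) (map flatten (trees k zs))
  words≡ : map flatten (trees (suc k) (x ∷ xs)) ≡ concatMap words (splits xs)
  words≡ = trans (map-concatMap flatten _ (splits xs))
    (concatMap-cong (λ (ys , zs) → map-cartesianProductWith flatten _ join flatten (λ _ _ → refl)
                                     (trees k ys) (trees k zs)) (splits xs))
  words-↭ : ∀ {ys zs} → (ys , zs) ∈ splits xs → ∀ {u} → u ∈ map flatten (trees k ys) → u ↭ ys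
  words-↭ {ys} s u∈ with T , T∈ , refl ← ∈-map⁻ flatten u∈ =
    trees-sound k ys (proj₁ (splits-length≤ xs s n≤k)) T∈
  x∉ : ∀ {ys zs} → (ys , zs) ∈ splits xs → ∀ {u} → u ∈ map flatten (trees k ys) → x ∉ u
  x∉ s u∈ x∈u = Unique.Unique[x∷xs]⇒x∉xs xs! (splits-⊆ˡ xs s (Perm.∈-resp-↭ (words-↭ s u∈) x∈u))
  block-unique : ∀ {s} → s ∈ splits xs → Unique (words s)
  block-unique {ys , zs} s
    with ys≤ , zs≤ ← splits-length≤ xs s n≤k
    with ys! , zs! ← splits-AllPairs xs s tail!
    = unique-cartesianProductWith join
        (λ u eq → ∷-injectiveʳ (++-cancelˡ u _ _ eq))
        (λ {u} {u′} u∈ u′∈ eq → split-at-injective u u′ (x∉ s u∈) (x∉ s u′∈) eq)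
        (trees-unique k ys ys≤ ys!) (trees-unique k zs zs≤ zs!)
  block-disjoint : ∀ {s s′} → s ∈ splits xs → s′ ∈ splits xs → Separated (proj₁ s) (proj₁ s′) →
    Disjoint (words s) (words s′)
  block-disjoint {ys , zs} {ys′ , zs′} s s′ (z , sep) (p , p′)
    with u , _ , u∈ , _ , refl ← ∈-cartesianProductWith⁻ join (map flatten (trees k ys)) _ p
    with u′ , _ , u′∈ , _ , eq ← ∈-cartesianProductWith⁻ join (map flatten (trees k ys′)) _ p′
    with refl ← split-at-injective u u′ (x∉ s u∈) (x∉ s′ u′∈) eq
    with sep
  ... | inj₁ (z∈ , z∉) = z∉ (Perm.∈-resp-↭ (words-↭ s′ u′∈) (Perm.∈-resp-↭ (↭-sym (words-↭ s u∈)) z∈))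
  ... | inj₂ (z∉ , z∈) = z∉ (Perm.∈-resp-↭ (words-↭ s u∈) (Perm.∈-resp-↭ (↭-sym (words-↭ s′ u′∈)) z∈))

-- Tail length, heap order and the enumeration of permutations

private variable
  n : ℕ

commonPrefix : List (Fin n) → List (Fin n) → ℕ
commonPrefix (x ∷ xs) (y ∷ ys) = if does (x Fin.≟ y) then suc (commonPrefix xs ys) else 0
commonPrefix _        _        = 0

-- The word ends in the root exactly when the right subtree is empty; the left subtree then has all
-- of the remaining labels and the comparison continues there. Otherwise the last letter belongs to
-- the right subtree and differs from the root.
tailLength-trees : ∀ k (xs : List (Fin n)) {T} → length xs ≤ k → Unique xs → T ∈ trees k xs →
  commonPrefix (reverse (flatten T)) xs ≡ tailLength T
tailLength-trees zero    []       _ _ (here refl) = refl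
tailLength-trees (suc k) []       _ _ (here refl) = refl
tailLength-trees (suc k) (x ∷ xs) (s≤s n≤k) xs!@(_ ∷ tail!) T∈
  with ∈-trees-∷⁻ k x xs T∈
... | ys , [] , s , l , r , l∈ , r∈ , refl
  with refl ← splits-[]ʳ xs s
  with here refl ← subst (r ∈_) (trees-[] k) r∈
  rewrite reverse-++ (flatten l) [ x ] | dec-true (x Fin.≟ x) refl
  = cong suc (tailLength-trees k xs n≤k tail! l∈)
... | ys , zs@(_ ∷ _) , s , l , leaf , l∈ , r∈ , refl
  = contradiction (Perm.↭-length (trees-sound k zs (proj₂ (splits-length≤ xs s n≤k)) r∈)) λ ()
... | ys , zs@(_ ∷ _) , s , l , r@(node _ _ _) , l∈ , r∈ , refl
  rewrite reverse-++ (flatten l) (x ∷ flatten r) | unfold-reverse x (flatten r)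
  with reverse (flatten r) | length-reverse (flatten r) | Perm.↭-reverse (flatten r)
... | [] | eq | _ = contradiction (trans eq (Perm.↭-length (trees-sound k zs (proj₂ (splits-length≤ xs s n≤k)) r∈))) λ ()
... | z ∷ _ | _ | rev↭
  rewrite dec-false (z Fin.≟ x) (λ { refl → Unique.Unique[x∷xs]⇒x∉xs xs! (splits-⊆ʳ xs s
            (Perm.∈-resp-↭ (trees-sound k zs (proj₂ (splits-length≤ xs s n≤k)) r∈)
              (Perm.∈-resp-↭ rev↭ (here refl)))) })
  = refl

-- Labels are compared through `f`, which is `id` when they are values and `lookup π` when they are
-- positions.
Heap : (A → Fin n) → Tree A → Set
Heap f leaf         = ⊤
Heap f (node l x r) = (∀ {y} → y ∈ flatten l → f y Fin.< f x) × (∀ {y} → y ∈ flatten r → f y Fin.< f x)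
                    × Heap f l × Heap f r

trees-heap : ∀ k (xs : List (Fin n)) {T} → length xs ≤ k → AllPairs Fin._>_ xs → T ∈ trees k xs → Heap id T
trees-heap zero    []       _         _ (here refl) = _
trees-heap (suc k) []       _         _ (here refl) = _
trees-heap (suc k) (x ∷ xs) (s≤s n≤k) (x> ∷ xs>) T∈
  with ys , zs , s , l , r , l∈ , r∈ , refl ← ∈-trees-∷⁻ k x xs T∈
  with ys≤ , zs≤ ← splits-length≤ xs s n≤k
  with ys> , zs> ← splits-AllPairs xs s xs>
  = (λ y∈ → All.lookup x> (splits-⊆ˡ xs s (Perm.∈-resp-↭ (trees-sound k ys ys≤ l∈) y∈)))
  , (λ y∈ → All.lookup x> (splits-⊆ʳ xs s (Perm.∈-resp-↭ (trees-sound k zs zs≤ r∈) y∈)))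
  , trees-heap k ys ys≤ ys> l∈ , trees-heap k zs zs≤ zs> r∈

∑ₗ-filter : {P : X → Set} (P? : Decidable P) (xs : List X) (f : X → ℕ) →
  ∑ₗ (filter P? xs) f ≡ ∑ₗ xs (λ x → if does (P? x) then f x else 0)
∑ₗ-filter P? []       f = refl
∑ₗ-filter P? (x ∷ xs) f with does (P? x)
... | true  = cong (f x ℕ.+_) (∑ₗ-filter P? xs f)
... | false = ∑ₗ-filter P? xs f

∈-vectors : ∀ {xs : List X} → (∀ x → x ∈ xs) → ∀ {k} (v : Vec X k) → v ∈ vectors xs k
∈-vectors all []      = here refl
∈-vectors all (x ∷ v) = ∈-cartesianProductWith⁺ _∷_ (all x) (∈-vectors all v)

vectors-unique : ∀ {xs : List X} → Unique xs → ∀ k → Unique (vectors xs k)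
vectors-unique xs! zero    = [] ∷ []
vectors-unique xs! (suc k) = Unique.cartesianProductWith⁺ _∷_ Vec.∷-injective xs! (vectors-unique xs! k)

toList-AllPairs⁺ : {R : Rel X 0ℓ} {v : Vec X n} → AllPairsᵛ R v → AllPairs R (toList v)
toList-AllPairs⁺ []         = []
toList-AllPairs⁺ (px ∷ pxs) = Allᵛ.toList⁺ px ∷ toList-AllPairs⁺ pxs

toList-AllPairs⁻ : {R : Rel X 0ℓ} (v : Vec X n) → AllPairs R (toList v) → AllPairsᵛ R v
toList-AllPairs⁻ []      []         = []
toList-AllPairs⁻ (_ ∷ v) (px ∷ pxs) = Allᵛ.toList⁻ px ∷ toList-AllPairs⁻ v pxs

toList-injective : (u v : Vec X n) → toList u ≡ toList v → u ≡ v
toList-injective u v eq = trans (sym (Vec.cast-is-id refl u)) (Vec.toList-injective refl u v eq)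

toList-surjective : (xs : List X) → length xs ≡ n → ∃ λ (v : Vec X n) → toList v ≡ xs
toList-surjective xs refl = fromList xs , Vec.toList∘fromList xs

-- Descending order serves twice: the head, which becomes the root, is the maximum, and the list is
-- what the reversed word must match along its tail.
countdown : ∀ n → List (Fin n)
countdown n = tabulate opposite

∈-countdown : (i : Fin n) → i ∈ countdown n
∈-countdown i = subst (_∈ countdown _) (Fin.opposite-involutive i) (∈-tabulate⁺ (opposite i))

countdown-unique : ∀ n → Unique (countdown n)
countdown-unique n = Unique.tabulate⁺ λ {i} {j} eq →
  trans (sym (Fin.opposite-involutive i)) (trans (cong opposite eq) (Fin.opposite-involutive j))

countdown-descending : ∀ n → AllPairs Fin._>_ (countdown n)
countdown-descending n = AllPairs.tabulate⁺-< λ {i} {j} i<j →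
  subst₂ _<_ (sym (Fin.opposite-prop j)) (sym (Fin.opposite-prop i))
    (∸-monoʳ-< (s≤s i<j) (Fin.toℕ<n j))

length-countdown : ∀ n → length (countdown n) ≡ n
length-countdown n = length-tabulate opposite

-- Neither list has repetitions, so it is enough to compare members. A word of n distinct letters of
-- `Fin n` rearranges `countdown n` and is therefore the flattening of a tree.
S-words : ∀ n → map toList (S n) ↭ map flatten (trees n (countdown n))
S-words n = unique-⊆⊇⇒↭
  (Unique.map⁺ (λ {u} {v} → toList-injective u v)
    (Unique.filter⁺ distinct? (vectors-unique (Unique.allFin⁺ n) n)))
  (trees-unique n (countdown n) n≤n (countdown-unique n))
  to from
  where
  distinct? = allPairs? (λ (a b : Fin n) → ¬? (a Fin.≟ b))
  n≤n = ≤-reflexive (length-countdown n)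
  to : map toList (S n) ⊆ map flatten (trees n (countdown n))
  to w∈ with π , π∈ , refl ← ∈-map⁻ toList w∈ =
    trees-complete n (countdown n) n≤n
      (unique-⊆⇒↭ (toList-AllPairs⁺ (proj₂ (∈-filter⁻ distinct? {xs = vectors (allFin n) n} π∈)))
        (λ {i} _ → ∈-countdown i)
        (≤-reflexive (trans (length-countdown n) (sym (Vec.length-toList π)))))
  from : map flatten (trees n (countdown n)) ⊆ map toList (S n)
  from w∈
    with T , T∈ , refl ← ∈-map⁻ flatten w∈
    with w↭ ← trees-sound n (countdown n) n≤n T∈
    with π , eq ← toList-surjective (flatten T) (trans (Perm.↭-length w↭) (length-countdown n))
    = subst (_∈ map toList (S n)) eq (∈-map⁺ toList (∈-filter⁺ distinct? (∈-vectors ∈-allFin π)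
        (toList-AllPairs⁻ π (subst Unique (sym eq)
          (PermSetoid.Unique-resp-↭ (setoid (Fin n)) (↭⇒↭ₛ (↭-sym w↭)) (countdown-unique n))))))

tabulate-∷ʳ : ∀ n (f : Fin (suc n) → X) → tabulate f ≡ tabulate (f ∘ inject₁) ++ [ f (fromℕ n) ]
tabulate-∷ʳ zero    f = refl
tabulate-∷ʳ (suc n) f = cong (f zero ∷_) (tabulate-∷ʳ n (f ∘ suc))

reverse-tabulate : ∀ n (f : Fin n → X) → reverse (tabulate f) ≡ tabulate (f ∘ opposite)
reverse-tabulate zero    f = refl
reverse-tabulate (suc n) f = begin
  reverse (tabulate f)
    ≡⟨ unfold-reverse (f zero) (tabulate (f ∘ suc)) ⟩
  reverse (tabulate (f ∘ suc)) ++ [ f zero ]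
    ≡⟨ cong (_++ [ f zero ]) (reverse-tabulate n (f ∘ suc)) ⟩
  tabulate (f ∘ suc ∘ opposite) ++ [ f zero ]
    ≡⟨ cong₂ (λ xs x → xs ++ [ f x ]) (tabulate-cong (cong f ∘ opposite-inject₁)) (opposite-fromℕ n) ⟨
  tabulate (f ∘ opposite ∘ inject₁) ++ [ f (opposite (fromℕ n)) ]
    ≡⟨ tabulate-∷ʳ n (f ∘ opposite) ⟨
  tabulate (f ∘ opposite) ∎
  where
  open ≡-Reasoning
  opposite-inject₁ : ∀ {n} (i : Fin n) → opposite (inject₁ i) ≡ suc (opposite i)
  opposite-inject₁ zero    = refl
  opposite-inject₁ (suc i) = cong inject₁ (opposite-inject₁ i)
  opposite-fromℕ : ∀ n → opposite (fromℕ n) ≡ zero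
  opposite-fromℕ zero    = refl
  opposite-fromℕ (suc n) = cong inject₁ (opposite-fromℕ n)

tabulate-lookup : (v : Vec X n) → tabulate (lookup v) ≡ toList v
tabulate-lookup []      = refl
tabulate-lookup (x ∷ v) = cong (x ∷_) (tabulate-lookup v)

commonPrefix-full : ∀ k (f g : Fin k → Fin n) → (∀ i → f i ≡ g i) →
  commonPrefix (tabulate f) (tabulate g) ≡ k
commonPrefix-full zero    f g eq = refl
commonPrefix-full (suc k) f g eq
  rewrite dec-true (f zero Fin.≟ g zero) (eq zero) = cong suc (commonPrefix-full k (f ∘ suc) (g ∘ suc) (eq ∘ suc))

commonPrefix-first : ∀ {k} (f g : Fin k → Fin n) i → f i ≢ g i →
  (∀ (j : Fin.Fin′ i) → f (Fin.inject j) ≡ g (Fin.inject j)) →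
  commonPrefix (tabulate f) (tabulate g) ≡ toℕ i
commonPrefix-first f g zero    f≢g _  rewrite dec-false (f zero Fin.≟ g zero) f≢g = refl
commonPrefix-first f g (suc i) f≢g eq rewrite dec-true (f zero Fin.≟ g zero) (eq zero) =
  cong suc (commonPrefix-first (f ∘ suc) (g ∘ suc) i f≢g (eq ∘ suc))

tl≡commonPrefix : (π : Vec (Fin n) n) → tl π ≡ commonPrefix (reverse (toList π)) (countdown n)
tl≡commonPrefix {n} π = trans lemma (cong (λ w → commonPrefix w (countdown n))
  (trans (sym (reverse-tabulate n (lookup π))) (cong reverse (tabulate-lookup π))))
  where
  lemma : tl π ≡ commonPrefix (tabulate (lookup π ∘ opposite)) (countdown n)
  lemma with Fin.all? (λ i → lookup π (opposite i) Fin.≟ opposite i)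
  ... | yes all = sym (commonPrefix-full n _ _ all)
  ... | no ¬all with i , i≢ , below ← Fin.¬∀⟶∃¬-smallest n
                  (λ i → lookup π (opposite i) ≡ opposite i)
                  (λ i → lookup π (opposite i) Fin.≟ opposite i) ¬all
    = sym (commonPrefix-first _ _ i i≢ below)

D-trees : (∀ {n} (π : Vec (Fin n) n) T → toList π ≡ flatten T → Heap id T → length (VHC π) ≡ hookCount T 0) →
  ∀ m n → D m n ≡ exactTotal n n m 0
D-trees VHC≡ m n = begin
  D m n
    ≡⟨ ∑ₗ-filter (λ π → tl π ℕ.≟ m) (S n) (λ π → length (VHC π)) ⟩
  ∑ₗ (S n) (λ π → if does (tl π ℕ.≟ m) then length (VHC π) else 0)
    ≡⟨ ∑ₗ-match toList flatten _ (exactCount m 0) (S n) (trees n (countdown n)) (S-words n) same ⟩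
  ∑ₗ (trees n (countdown n)) (exactCount m 0)
    ≡⟨ ∑-exactCount n (countdown n) n≤n m 0 ⟩
  exactTotal n (length (countdown n)) m 0
    ≡⟨ cong (λ k → exactTotal n k m 0) (length-countdown n) ⟩
  exactTotal n n m 0 ∎
  where
  open ≡-Reasoning
  n≤n = ≤-reflexive (length-countdown n)
  same : ∀ {π T} → π ∈ S n → T ∈ trees n (countdown n) → toList π ≡ flatten T →
    (if does (tl π ℕ.≟ m) then length (VHC π) else 0) ≡ exactCount m 0 T
  same {π} {T} _ T∈ eq = cong₂ (λ t h → if does (t ℕ.≟ m) then h else 0)
    (trans (tl≡commonPrefix π)
      (trans (cong (λ w → commonPrefix (reverse w) (countdown n)) eq)
             (tailLength-trees n (countdown n) n≤n (countdown-unique n) T∈)))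
    (VHC≡ π T eq (trees-heap n (countdown n) n≤n (countdown-descending n) T∈))

-- Hook configurations along a tree

-- The choices of an endpoint q for the root's hook: the entries before q stay available to the
-- right subtree, those after q to the left one.
picks : List X → List (List X × X × List X)
picks []       = []
picks (x ∷ xs) = ([] , x , xs) ∷ map (λ (a , q , b) → x ∷ a , q , b) (picks xs)

picks-++ : (xs : List X) {a b : List X} {q : X} → (a , q , b) ∈ picks xs → xs ≡ a ++ q ∷ b
picks-++ (x ∷ xs) (here refl) = refl
picks-++ (x ∷ xs) (there p) with _ , p′ , refl ← ∈-map⁻ _ p = cong (x ∷_) (picks-++ xs p′)

∈-picks : {xs : List X} {q : X} → q ∈ xs → ∃₂ λ a b → (a , q , b) ∈ picks xs
∈-picks (here refl) = _ , _ , here refl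
∈-picks (there q∈) with a , b , p ← ∈-picks q∈ = _ , b , there (∈-map⁺ _ p)

map-picks : (xs : List X) → map (proj₁ ∘ proj₂) (picks xs) ≡ xs
map-picks []       = refl
map-picks (x ∷ xs) = cong (x ∷_)
  (trans (sym (map-∘ (picks xs))) (map-picks xs))

∑-picks : (xs : List X) (g : ℕ → ℕ → ℕ) → let t = length xs in
  ∑ₗ (picks xs) (λ (a , _ , b) → g (length a) (length b)) ≡ ∑ t (λ s → g s (t ∸ suc s))
∑-picks []       g = refl
∑-picks (x ∷ xs) g = cong (g 0 (length xs) +_)
  (trans (∑ₗ-map _ (picks xs) _) (∑-picks xs (g ∘ suc)))

AllPairs-++⁻ : {R : Rel X 0ℓ} (xs : List X) {ys : List X} → AllPairs R (xs ++ ys) →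
  AllPairs R xs × AllPairs R ys × (∀ {x y} → x ∈ xs → y ∈ ys → R x y)
AllPairs-++⁻ []       rys       = [] , rys , λ ()
AllPairs-++⁻ (x ∷ xs) (rx ∷ rs) with a , b , c ← AllPairs-++⁻ xs rs =
  All.++⁻ˡ xs rx ∷ a , b ,
  λ { (here refl) y∈ → All.lookup rx (∈-++⁺ʳ xs y∈) ; (there x∈) y∈ → c x∈ y∈ }

map-≡-++ : (g : X → Y) (xs : List X) (us : List Y) {v : Y} {vs : List Y} → map g xs ≡ us ++ v ∷ vs →
  ∃₂ λ as x → ∃ λ bs → xs ≡ as ++ x ∷ bs × map g as ≡ us × g x ≡ v × map g bs ≡ vs
map-≡-++ g (x ∷ xs) []       eq with p , q ← ∷-injective eq = [] , x , xs , refl , refl , p , q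
map-≡-++ g (x ∷ xs) (u ∷ us) eq
  with refl , eq′ ← ∷-injective eq
  with as , y , bs , refl , p , q , r ← map-≡-++ g xs us eq′
  = x ∷ as , y , bs , refl , cong (u ∷_) p , q , r

++-injective : (us us′ : List X) {vs vs′ : List X} → length us ≡ length us′ →
  us ++ vs ≡ us′ ++ vs′ → us ≡ us′ × vs ≡ vs′
++-injective []       []         _   eq = refl , eq
++-injective (u ∷ us) (u′ ∷ us′) len eq
  with refl , eq′ ← ∷-injective eq
  with p , q ← ++-injective us us′ (suc-injective len) eq′ = cong (u ∷_) p , q

∑ₗ-1 : (xs : List X) → ∑ₗ xs (const 1) ≡ length xs
∑ₗ-1 []       = refl
∑ₗ-1 (x ∷ xs) = cong suc (∑ₗ-1 xs)

mapTree : (X → Y) → Tree X → Tree Y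
mapTree f leaf         = leaf
mapTree f (node l x r) = node (mapTree f l) (f x) (mapTree f r)

hookCount-mapTree : (f : X → Y) (P : Tree X) → ∀ t → hookCount (mapTree f P) t ≡ hookCount P t
hookCount-mapTree f leaf                      t = refl
hookCount-mapTree f (node l p leaf)           t = hookCount-mapTree f l (suc t)
hookCount-mapTree f (node l p r@(node _ _ _)) t =
  ∑-cong t (λ s _ → cong₂ _*_ (hookCount-mapTree f l (suc (t ∸ suc s))) (hookCount-mapTree f r s))

flatten-mapTree : (f : X → Y) (P : Tree X) → flatten (mapTree f P) ≡ map f (flatten P)
flatten-mapTree f leaf         = refl
flatten-mapTree f (node l p r) = trans
  (cong₂ (λ u v → u ++ f p ∷ v) (flatten-mapTree f l) (flatten-mapTree f r))
  (sym (map-++ f (flatten l) (p ∷ flatten r)))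

heap-mapTree : (f : X → Fin n) (P : Tree X) → Heap id (mapTree f P) → Heap f P
heap-mapTree f leaf         _ = tt
heap-mapTree f (node l p r) (hl , hr , Hl , Hr) =
    (λ y∈ → hl (subst (_ ∈_) (sym (flatten-mapTree f l)) (∈-map⁺ f y∈)))
  , (λ y∈ → hr (subst (_ ∈_) (sym (flatten-mapTree f r)) (∈-map⁺ f y∈)))
  , heap-mapTree f l Hl , heap-mapTree f r Hr

-- Carries the shape of a tree of values over to the positions at which the values stand.
unflatten : (f : X → Y) (T : Tree Y) (ps : List X) → map f ps ≡ flatten T →
  ∃ λ P → flatten P ≡ ps × mapTree f P ≡ T
unflatten f leaf         []  eq = leaf , refl , refl
unflatten f (node l x r) ps eq
  with as , p , bs , refl , eqˡ , refl , eqʳ ← map-≡-++ f ps (flatten l) eq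
  with l′ , refl , refl ← unflatten f l as eqˡ
  with r′ , refl , refl ← unflatten f r bs eqʳ
  = node l′ p r′ , refl , refl

treeDescents : Tree X → List X
treeDescents leaf                      = []
treeDescents (node l p leaf)           = treeDescents l
treeDescents (node l p r@(node _ _ _)) = treeDescents l ++ p ∷ treeDescents r

treeDescents-⊆ : (P : Tree X) → treeDescents P ⊆ flatten P
treeDescents-⊆ (node l p leaf) i∈ = ∈-++⁺ˡ (treeDescents-⊆ l i∈)
treeDescents-⊆ (node l p r@(node _ _ _)) i∈
  with ihˡ ← (λ {i} → treeDescents-⊆ l {i}) | ihʳ ← (λ {i} → treeDescents-⊆ r {i})
  with ∈-++⁻ (treeDescents l) i∈
... | inj₁ q           = ∈-++⁺ˡ (ihˡ q)
... | inj₂ (here refl) = ∈-++⁺ʳ (flatten l) (here refl)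
... | inj₂ (there q)   = ∈-++⁺ʳ (flatten l) (there (ihʳ q))

-- The hook configurations of the descents of a segment P, whose northeast
-- endpoints lie in P or among the later positions T.
configs : Tree (Fin n) → List (Fin n) → List (List (Hook n))
configs leaf                      T = [ [] ]
configs (node l p leaf)           T = configs l (p ∷ T)
configs (node l p r@(node _ _ _)) T = concatMap
  (λ (a , q , b) → cartesianProductWith (λ hs ks → hs ++ (p , q) ∷ ks) (configs l (p ∷ b)) (configs r a))
  (picks T)

∈-configs⁻ : ∀ (l : Tree (Fin n)) p r₁ y r₂ T {hs} → let r = node r₁ y r₂ in hs ∈ configs (node l p r) T →
  ∃₂ λ a q → ∃ λ b → (a , q , b) ∈ picks T × ∃₂ λ as bs →
    as ∈ configs l (p ∷ b) × bs ∈ configs r a × hs ≡ as ++ (p , q) ∷ bs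
∈-configs⁻ l p r₁ y r₂ T hs∈
  with ws , m , w ← ∈-concat⁻′ (map _ (picks T)) hs∈
  with (a , q , b) , s , refl ← ∈-map⁻ _ w
  = a , q , b , s , ∈-cartesianProductWith⁻ _ (configs l (p ∷ b)) (configs (node r₁ y r₂) a) m

-- A choice (a, q, b) is the term s = `length a` of the root formula; the left subtree may use the
-- root and all of `b`.
length-configs : (P : Tree (Fin n)) (T : List (Fin n)) → length (configs P T) ≡ hookCount P (length T)
length-configs leaf                      T = refl
length-configs (node l p leaf)           T = length-configs l (p ∷ T)
length-configs (node l p r@(node _ _ _)) T with ihˡ ← length-configs l | ihʳ ← length-configs r = begin
  length (configs (node l p r) T)
    ≡⟨ ∑ₗ-1 (configs (node l p r) T) ⟨
  ∑ₗ (configs (node l p r) T) (const 1)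
    ≡⟨ ∑ₗ-concatMap _ (picks T) (const 1) ⟩
  _ ≡⟨ ∑ₗ-cong (picks T) (λ (a , q , b) _ → block a q b) ⟩
  ∑ₗ (picks T) (λ (a , q , b) → g (length a) (length b))
    ≡⟨ ∑-picks T g ⟩
  hookCount (node l p r) (length T) ∎
  where
  open ≡-Reasoning
  g : ℕ → ℕ → ℕ
  g s t = hookCount l (suc t) * hookCount r s
  block : ∀ a q b → ∑ₗ (cartesianProductWith (λ hs ks → hs ++ (p , q) ∷ ks)
                       (configs l (p ∷ b)) (configs r a)) (const 1) ≡ g (length a) (length b)
  block a q b = begin
    _ ≡⟨ ∑ₗ-cartesianProductWith _ (configs l (p ∷ b)) (configs r a) (const 1) ⟩
    ∑ₗ (configs l (p ∷ b)) (λ _ → ∑ₗ (configs r a) (const 1))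
      ≡⟨ ∑ₗ-cong (configs l (p ∷ b)) (λ _ _ → sym (*-identityˡ _)) ⟩
    ∑ₗ (configs l (p ∷ b)) (λ _ → 1 * ∑ₗ (configs r a) (const 1))
      ≡⟨ ∑ₗ-*ʳ (∑ₗ (configs r a) (const 1)) (configs l (p ∷ b)) (const 1) ⟩
    ∑ₗ (configs l (p ∷ b)) (const 1) * ∑ₗ (configs r a) (const 1)
      ≡⟨ cong₂ _*_ (trans (∑ₗ-1 (configs l (p ∷ b))) (ihˡ (p ∷ b)))
                   (trans (∑ₗ-1 (configs r a)) (ihʳ a)) ⟩
    g (length a) (length b) ∎

configs-sw : (P : Tree (Fin n)) {T : List (Fin n)} → ∀ {hs} → hs ∈ configs P T → map sw hs ≡ treeDescents P
configs-sw leaf                      (here refl) = refl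
configs-sw (node l p leaf)           hs∈ = configs-sw l hs∈
configs-sw (node l p r@(node r₁ y r₂)) {T} hs∈
  with ihˡ ← (λ {T} {hs} → configs-sw l {T} {hs}) | ihʳ ← (λ {T} {hs} → configs-sw r {T} {hs})
  with _ , _ , _ , _ , as , bs , as∈ , bs∈ , refl ← ∈-configs⁻ l p r₁ y r₂ T hs∈
  = trans (map-++ sw as _) (cong₂ (λ u v → u ++ p ∷ v) (ihˡ as∈) (ihʳ bs∈))

picks-unique : {xs : List X} → Unique xs → ∀ {a q b} → (a , q , b) ∈ picks xs →
  Unique a × Unique (q ∷ b)
picks-unique {xs = xs} xs! {a} s with a! , qb! , _ ← AllPairs-++⁻ a (subst Unique (picks-++ xs s) xs!) = a! , qb!

-- The hooks of the left subtree form a prefix whose length is its number of descents, so equal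
-- concatenations agree part by part. The hook at `p` follows this prefix and reveals q, which
-- separates the blocks.
configs-unique : (P : Tree (Fin n)) (T : List (Fin n)) → Unique (flatten P ++ T) → Unique (configs P T)
configs-unique leaf                      T _ = [] ∷ []
configs-unique (node l p leaf)           T u =
  configs-unique l (p ∷ T) (subst Unique (++-assoc (flatten l) [ p ] T) u)
configs-unique {n} (node l p r@(node _ _ _)) T u
  with ihˡ ← configs-unique l | ihʳ ← configs-unique r
  = unique-concatMap block unique-block
      (AllPairs.map (λ {s} {s′} q≢q′ {w} → disjoint s s′ q≢q′ {w})
        (AllPairs.map⁻ (subst Unique (sym (map-picks T)) T!)))
  where
  block : List (Fin n) × Fin n × List (Fin n) → List (List (Hook n))
  block (a , q , b) = cartesianProductWith (λ hs ks → hs ++ (p , q) ∷ ks) (configs l (p ∷ b)) (configs r a)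
  l! = proj₁ (AllPairs-++⁻ (flatten l) (proj₁ (AllPairs-++⁻ (flatten l ++ p ∷ flatten r) u)))
  pr! = proj₁ (proj₂ (AllPairs-++⁻ (flatten l) (proj₁ (AllPairs-++⁻ (flatten l ++ p ∷ flatten r) u))))
  T! = proj₁ (proj₂ (AllPairs-++⁻ (flatten l ++ p ∷ flatten r) u))
  same-length : ∀ {T′ T″ as as′} → as ∈ configs l T′ → as′ ∈ configs l T″ → length as ≡ length as′
  same-length {as = as} {as′} as∈ as′∈ = trans (sym (length-map sw as))
    (trans (cong length (trans (configs-sw l as∈) (sym (configs-sw l as′∈)))) (length-map sw as′))
  ⊆T : ∀ {a q b} → (a , q , b) ∈ picks T → a ++ q ∷ b ⊆ T
  ⊆T s x∈ = subst (_ ∈_) (sym (picks-++ T s)) x∈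
  sep = proj₂ (proj₂ (AllPairs-++⁻ (flatten l ++ p ∷ flatten r) u))
  sepˡ = proj₂ (proj₂ (AllPairs-++⁻ (flatten l) (proj₁ (AllPairs-++⁻ (flatten l ++ p ∷ flatten r) u))))
  unique-block : ∀ {s} → s ∈ picks T → Unique (block s)
  unique-block {a , q , b} s with a! , _ ∷ b! ← picks-unique T! s =
    unique-cartesianProductWith _
      (λ hs eq → ∷-injectiveʳ (++-cancelˡ hs _ _ eq))
      (λ {as} {as′} as∈ as′∈ eq → proj₁ (++-injective as as′ (same-length as∈ as′∈) eq))
      (ihˡ (p ∷ b) (AllPairs.++⁺ l!
        (All.tabulate (λ z∈ → sep (∈-++⁺ʳ (flatten l) (here refl)) (⊆T s (∈-++⁺ʳ a (there z∈)))) ∷ b!)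
        (All.tabulate λ x∈ → All.tabulate λ
          { (here refl) → sepˡ x∈ (here refl)
          ; (there z∈)  → sep (∈-++⁺ˡ x∈) (⊆T s (∈-++⁺ʳ a (there z∈))) })))
      (ihʳ a (AllPairs.++⁺ (AllPairs.tail pr!) a!
        (All.tabulate λ x∈ → All.tabulate λ z∈ → sep (∈-++⁺ʳ (flatten l) (there x∈)) (⊆T s (∈-++⁺ˡ z∈)))))
  disjoint : ∀ s s′ → proj₁ (proj₂ s) ≢ proj₁ (proj₂ s′) → Disjoint (block s) (block s′)
  disjoint (a , q , b) (a′ , q′ , b′) q≢q′ (h , h′)
    with as , _ , as∈ , _ , refl ← ∈-cartesianProductWith⁻ _ (configs l (p ∷ b)) (configs r a) h
    with as′ , _ , as′∈ , _ , eq ← ∈-cartesianProductWith⁻ _ (configs l (p ∷ b′)) (configs r a′) h′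
    with _ , eq′ ← ++-injective as as′ (same-length as∈ as′∈) eq
    = q≢q′ (cong proj₂ (proj₁ (∷-injective eq′)))

starts-in : ∀ (P : Tree (Fin n)) {hs} → map sw hs ≡ treeDescents P → ∀ {H} → H ∈ hs → sw H ∈ flatten P
starts-in P eq H∈ = treeDescents-⊆ P (subst (_ ∈_) eq (∈-map⁺ sw H∈))

-- Valid configurations on a window are exactly the listed ones

module _ (π : Vec (Fin n) n) where

  private
    f : Fin n → Fin n
    f = lookup π

  data Ordered : Tree (Fin n) → Set where
    leaf : Ordered leaf
    node : ∀ {l p r} → (∀ {i} → i ∈ flatten l → i Fin.< p) → (∀ {i} → i ∈ flatten r → p Fin.< i) →
           Ordered l → Ordered r → Ordered (node l p r)

  -- P is a contiguous segment of positions, and T consists of later positions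
  -- whose values exceed all values between P and them.
  record Window (P : Tree (Fin n)) (T : List (Fin n)) : Set where
    field
      ordered  : Ordered P
      heap     : Heap f P
      convex   : ∀ {i j k} → i ∈ flatten P → k ∈ flatten P → i Fin.≤ j → j Fin.≤ k → j ∈ flatten P
      sorted   : AllPairs Fin._<_ T
      later    : ∀ {i q} → i ∈ flatten P → q ∈ T → i Fin.< q
      dominant : ∀ {i q j} → i ∈ flatten P → q ∈ T → i Fin.≤ j → j Fin.< q → f j Fin.< f q

  module Split {l r : Tree (Fin n)} {p : Fin n} {T : List (Fin n)} (W : Window (node l p r) T) where
    open Window W

    l<p : ∀ {i} → i ∈ flatten l → i Fin.< p
    l<p with node h _ _ _ ← ordered = h

    p<r : ∀ {i} → i ∈ flatten r → p Fin.< i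
    p<r with node _ h _ _ ← ordered = h

    ordered-l : Ordered l
    ordered-l with node _ _ h _ ← ordered = h

    ordered-r : Ordered r
    ordered-r with node _ _ _ h ← ordered = h

    heap-l : ∀ {i} → i ∈ flatten l → f i Fin.< f p
    heap-l = proj₁ heap

    heap-r : ∀ {i} → i ∈ flatten r → f i Fin.< f p
    heap-r = proj₁ (proj₂ heap)

    inˡ : ∀ {i} → i ∈ flatten l → i ∈ flatten (node l p r)
    inˡ = ∈-++⁺ˡ

    inᵖ : p ∈ flatten (node l p r)
    inᵖ = ∈-++⁺ʳ (flatten l) (here refl)

    inʳ : ∀ {i} → i ∈ flatten r → i ∈ flatten (node l p r)
    inʳ i∈ = ∈-++⁺ʳ (flatten l) (there i∈)

    before : ∀ {i} → i ∈ flatten (node l p r) → i Fin.< p → i ∈ flatten l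
    before i∈ i<p with ∈-++⁻ (flatten l) i∈
    ... | inj₁ q           = q
    ... | inj₂ (here refl) = contradiction i<p (<-irrefl refl)
    ... | inj₂ (there q)   = contradiction i<p (<-asym (p<r q))

    after : ∀ {i} → i ∈ flatten (node l p r) → p Fin.< i → i ∈ flatten r
    after i∈ p<i with ∈-++⁻ (flatten l) i∈
    ... | inj₁ q           = contradiction p<i (<-asym (l<p q))
    ... | inj₂ (here refl) = contradiction p<i (<-irrefl refl)
    ... | inj₂ (there q)   = q

    -- The root stands after `l` and exceeds all of it, so it becomes the first available endpoint.
    -- Dropping entries of `T` does no harm, because dominance speaks of all positions in between
    -- and not only of members of `T`.
    window-l : ∀ {T′} → T′ ⊆ T → AllPairs Fin._<_ T′ → Window l (p ∷ T′)
    window-l {T′} T′⊆T T′< = record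
      { ordered  = ordered-l
      ; heap     = proj₁ (proj₂ (proj₂ heap))
      ; convex   = λ i∈ k∈ i≤j j≤k → before (convex (inˡ i∈) (inˡ k∈) i≤j j≤k) (≤-<-trans j≤k (l<p k∈))
      ; sorted   = All.tabulate (λ q∈ → later inᵖ (T′⊆T q∈)) ∷ T′<
      ; later    = λ { i∈ (here refl) → l<p i∈ ; i∈ (there q∈) → later (inˡ i∈) (T′⊆T q∈) }
      ; dominant = λ { i∈ (here refl) i≤j j<p → heap-l (before (convex (inˡ i∈) inᵖ i≤j (<⇒≤ j<p)) j<p)
                     ; i∈ (there q∈) → dominant (inˡ i∈) (T′⊆T q∈) }
      }

    window-r : ∀ {T′} → T′ ⊆ T → AllPairs Fin._<_ T′ → Window r T′
    window-r {T′} T′⊆T T′< = record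
      { ordered  = ordered-r
      ; heap     = proj₂ (proj₂ (proj₂ heap))
      ; convex   = λ i∈ k∈ i≤j j≤k → after (convex (inʳ i∈) (inʳ k∈) i≤j j≤k) (<-≤-trans (p<r i∈) i≤j)
      ; sorted   = T′<
      ; later    = λ i∈ q∈ → later (inʳ i∈) (T′⊆T q∈)
      ; dominant = λ i∈ q∈ → dominant (inʳ i∈) (T′⊆T q∈)
      }

    module Pick {a q b} (s : (a , q , b) ∈ picks T) where

      T≡ : T ≡ a ++ q ∷ b
      T≡ = picks-++ T s

      a⊆T : a ⊆ T
      a⊆T x∈ = subst (_ ∈_) (sym T≡) (∈-++⁺ˡ x∈)

      q∈T : q ∈ T
      q∈T = subst (_ ∈_) (sym T≡) (∈-++⁺ʳ a (here refl))

      b⊆T : b ⊆ T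
      b⊆T x∈ = subst (_ ∈_) (sym T≡) (∈-++⁺ʳ a (there x∈))

      private
        parts = AllPairs-++⁻ a (subst (AllPairs Fin._<_) T≡ sorted)

      a<q : ∀ {x} → x ∈ a → x Fin.< q
      a<q x∈ = proj₂ (proj₂ parts) x∈ (here refl)

      q<b : ∀ {x} → x ∈ b → q Fin.< x
      q<b = All.lookup (AllPairs.head (proj₁ (proj₂ parts)))

      p<q : p Fin.< q
      p<q = later inᵖ q∈T

      fp<fq : f p Fin.< f q
      fp<fq = dominant inᵖ q∈T ≤-refl p<q

      below-q : ∀ {j} → p Fin.≤ j → j Fin.< q → f j Fin.< f q
      below-q = dominant inᵖ q∈T

      -- As q lies between p and x, the dominance of x over the positions from p on covers q: values
      -- increase along `T`.
      fq<b : ∀ {x} → x ∈ b → f q Fin.< f x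
      fq<b x∈ = dominant inᵖ (b⊆T x∈) (<⇒≤ p<q) (q<b x∈)

      window-l′ : Window l (p ∷ b)
      window-l′ = window-l b⊆T (AllPairs.tail (proj₁ (proj₂ parts)))

      window-r′ : Window r a
      window-r′ = window-r a⊆T (proj₁ parts)

  Good : Hook n → Set
  Good H = IsHook π H × NothingAbove π H

  -- The conditions of `IsVHC` for the descents of one segment. The field `ends` carries the
  -- restriction to available endpoints through the induction; for the whole permutation every
  -- position lies in the segment.
  record Valid (P : Tree (Fin n)) (T : List (Fin n)) (hs : List (Hook n)) : Set where
    field
      starts     : map sw hs ≡ treeDescents P
      good       : All Good hs
      compatible : AllPairs (Compatible π) hs
      ends       : All (λ H → ne H ∈ flatten P ⊎ ne H ∈ T) hs

  onHook-left : ∀ {H x y} → IsHook π H → OnHook π H x y → sw H Fin.≤ x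
  onHook-left isH (inj₁ (refl , _))         = ≤-refl
  onHook-left isH (inj₂ ((sw≤x , _) , _))   = sw≤x

  onHook-top : ∀ {H x y} → IsHook π H → OnHook π H x y → y Fin.≤ f (ne H)
  onHook-top isH (inj₁ (_ , _ , y≤)) = y≤
  onHook-top isH (inj₂ (_ , refl))   = ≤-refl

  -- Dominance of q makes (p, q) a hook with nothing above it. Hooks of the right subtree start
  -- after p and end between p and q, hence below level f q, and so they miss both parts of the
  -- root's hook.
  configs-valid : ∀ P T → Window P T → ∀ {hs} → hs ∈ configs P T → Valid P T hs
  configs-valid leaf T W (here refl) = record { starts = refl ; good = [] ; compatible = [] ; ends = [] }
  configs-valid (node l p leaf) T W {hs} hs∈ = record
    { starts     = V.starts
    ; good       = V.good
    ; compatible = V.compatible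
    ; ends       = All.map (λ { (inj₁ k∈) → inj₁ (inˡ k∈) ; (inj₂ (here refl)) → inj₁ inᵖ
                              ; (inj₂ (there k∈)) → inj₂ k∈ }) V.ends
    }
    where
    open Split W
    module V = Valid (configs-valid l (p ∷ T) (window-l id (Window.sorted W)) hs∈)
  configs-valid (node l p r@(node r₁ y r₂)) T W hs∈
    with ihˡ ← configs-valid l | ihʳ ← configs-valid r
    with a , q , b , s , as , bs , as∈ , bs∈ , refl ← ∈-configs⁻ l p r₁ y r₂ T hs∈
    = record
    { starts     = trans (map-++ sw as _) (cong₂ (λ u v → u ++ p ∷ v) L.starts R.starts)
    ; good       = All.++⁺ L.good (((p<q , fp<fq) , λ j p<j j<q → below-q (<⇒≤ p<j) j<q) ∷ R.good)
    ; compatible = AllPairs.++⁺ L.compatible (All.tabulate root-right ∷ R.compatible)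
        (All.tabulate λ H∈ → All.tabulate λ
          { (here refl) → left-cross H∈ (p<q , fp<fq) ≤-refl ≤-refl
          ; (there K∈)  → left-cross H∈ (proj₁ (All.lookup R.good K∈)) (<⇒≤ (p<r (starts-in r R.starts K∈)))
                            (<⇒≤ (right-below K∈)) })
    ; ends       = All.++⁺
        (All.map (λ { (inj₁ k∈) → inj₁ (inˡ k∈) ; (inj₂ (here refl)) → inj₁ inᵖ
                    ; (inj₂ (there k∈)) → inj₂ (b⊆T k∈) }) L.ends)
        (inj₂ q∈T ∷ All.map (λ { (inj₁ k∈) → inj₁ (inʳ k∈) ; (inj₂ k∈) → inj₂ (a⊆T k∈) }) R.ends)
    }
    where
    open Split W
    open Pick s
    module L = Valid (ihˡ (p ∷ b) window-l′ as∈)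
    module R = Valid (ihʳ a window-r′ bs∈)

    right-below : ∀ {K} → K ∈ bs → f (ne K) Fin.< f q
    right-below {K} K∈ with All.lookup R.ends K∈
    ... | inj₁ k∈ = below-q (<⇒≤ (p<r k∈)) (Window.later W (inʳ k∈) q∈T)
    ... | inj₂ k∈ = below-q (<⇒≤ (Window.later W inᵖ (a⊆T k∈))) (a<q k∈)

    -- A left hook that ends in `l` stays left of p. One that ends in `b` has its horizontal part
    -- above level f q, which K does not exceed. One that ends at p can meet K only at p, and there
    -- its northeast endpoint is the southwest endpoint of K.
    left-cross : ∀ {H K} → H ∈ as → IsHook π K → p Fin.≤ sw K → f (ne K) Fin.≤ f q → Compatible π H K
    left-cross {H} {K} H∈ isK p≤K K≤q x y onH onK with onH
    ... | inj₁ (refl , _) = contradiction (≤-trans p≤K (onHook-left isK onK))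
                              (<⇒≱ (l<p (starts-in l L.starts H∈)))
    ... | inj₂ ((_ , x≤k) , y≡) with All.lookup L.ends H∈
    ...   | inj₁ k∈ = contradiction (≤-trans (≤-trans p≤K (onHook-left isK onK)) x≤k) (<⇒≱ (l<p k∈))
    ...   | inj₂ (there k∈) = contradiction
              (subst (Fin._≤ f q) y≡ (≤-trans (onHook-top isK onK) K≤q)) (<⇒≱ (fq<b k∈))
    ...   | inj₂ (here k≡p) =
              inj₁ ((x≡k , y≡) , (x≡swK , trans y≡ (cong f (trans (sym x≡k) x≡swK))))
      where
      x≤p : x Fin.≤ p
      x≤p = subst (x Fin.≤_) k≡p x≤k
      x≡k : x ≡ ne H
      x≡k = trans (Fin.≤-antisym x≤p (≤-trans p≤K (onHook-left isK onK))) (sym k≡p)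
      x≡swK : x ≡ sw K
      x≡swK = Fin.≤-antisym (≤-trans x≤p p≤K) (onHook-left isK onK)

    root-right : ∀ {K} → K ∈ bs → Compatible π (p , q) K
    root-right {K} K∈ x y onH onK with onH
    ... | inj₁ (refl , _) = contradiction (onHook-left (proj₁ (All.lookup R.good K∈)) onK)
                              (<⇒≱ (p<r (starts-in r R.starts K∈)))
    ... | inj₂ (_ , refl) = contradiction (onHook-top (proj₁ (All.lookup R.good K∈)) onK)
                              (<⇒≱ (right-below K∈))

  -- The hook at p has to rise above f p, which no value of the right subtree does, so it ends at
  -- some q in `T`. Noncrossing with this hook then confines all others: left hooks to `l`, p or
  -- `b`, right hooks to `r` or `a`.
  valid-configs : ∀ P T → Window P T → ∀ {hs} → Valid P T hs → hs ∈ configs P T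
  valid-configs leaf T W {[]} V = here refl
  valid-configs leaf T W {_ ∷ _} V with () ← Valid.starts V
  valid-configs (node l p leaf) T W V = valid-configs l (p ∷ T) (window-l id (Window.sorted W)) record
    { starts     = V.starts
    ; good       = V.good
    ; compatible = V.compatible
    ; ends       = All.map ends V.ends
    }
    where
    open Split W
    module V = Valid V
    ends : ∀ {k} → k ∈ flatten l ++ [ p ] ⊎ k ∈ T → k ∈ flatten l ⊎ k ∈ p ∷ T
    ends (inj₂ k∈) = inj₂ (there k∈)
    ends (inj₁ k∈) with ∈-++⁻ (flatten l) k∈
    ... | inj₁ m           = inj₁ m
    ... | inj₂ (here refl) = inj₂ (here refl)
  valid-configs (node l p r@(node _ _ _)) T W {hs} V
    with ihˡ ← valid-configs l | ihʳ ← valid-configs r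
    with as , (_ , q) , bs , refl , startsˡ , refl , startsʳ ← map-≡-++ sw hs (treeDescents l) (Valid.starts V)
    with goodˡ , (isPQ , above) ∷ goodʳ ← All.++⁻ as (Valid.good V)
    with endsˡ , endPQ ∷ endsʳ ← All.++⁻ as (Valid.ends V)
    with compˡ , compPQ ∷ compʳ , cross ← AllPairs-++⁻ as (Valid.compatible V)
    = found endPQ
    where
    open Split W
    found : q ∈ flatten (node l p r) ⊎ q ∈ T → as ++ (p , q) ∷ bs ∈ configs (node l p r) T
    found (inj₁ q∈) = contradiction (proj₂ isPQ) (<-asym (heap-r (after q∈ (proj₁ isPQ))))
    found (inj₂ q∈) with a , b , s ← ∈-picks q∈ =
      ∈-concat⁺′ (∈-cartesianProductWith⁺ _
          (ihˡ (p ∷ b) window-l′ record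
            { starts = startsˡ ; good = goodˡ ; compatible = compˡ ; ends = All.tabulate end-l })
          (ihʳ a window-r′ record
            { starts = startsʳ ; good = goodʳ ; compatible = compʳ ; ends = All.tabulate end-r }))
        (∈-map⁺ _ s)
      where
      open Pick s
      locate : ∀ {k} → k ∈ T → k ∈ a ⊎ k ∈ q ∷ b
      locate k∈ = ∈-++⁻ a (subst (_ ∈_) T≡ k∈)

      end-l : ∀ {H} → H ∈ as → ne H ∈ flatten l ⊎ ne H ∈ p ∷ b
      end-l {i , k} H∈ = case-end (All.lookup endsˡ H∈)
        where
        i∈l = starts-in l startsˡ H∈
        compat : Compatible π (i , k) (p , q)
        compat = cross H∈ (here refl)
        -- The horizontal part of the left hook would meet the vertical part of the root's hook at
        -- (p, f k). A permitted contact there would require p = k or p = q.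
        crossing : f p Fin.≤ f k → f k Fin.≤ f q → p Fin.< k → ⊥
        crossing fp≤fk fk≤fq p<k with compat p (f k) (inj₂ ((<⇒≤ (l<p i∈l) , <⇒≤ p<k) , refl))
                                                      (inj₁ (refl , fp≤fk , fk≤fq))
        ... | inj₁ ((p≡k , _) , _) = <-irrefl (cong toℕ p≡k) p<k
        ... | inj₂ ((p≡q , _) , _) = <-irrefl (cong toℕ p≡q) p<q
        case-end : k ∈ flatten (node l p r) ⊎ k ∈ T → k ∈ flatten l ⊎ k ∈ p ∷ b
        case-end (inj₁ k∈) with ∈-++⁻ (flatten l) k∈
        ... | inj₁ m           = inj₁ m
        ... | inj₂ (here refl) = inj₂ (here refl)
        -- Here p lies strictly between i and k and has a larger value than k, so its point would be
        -- above the hook.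
        ... | inj₂ (there m)   = contradiction
                (proj₂ (All.lookup goodˡ H∈) p (l<p i∈l) (p<r m)) (<-asym (heap-r m))
        case-end (inj₂ k∈) with locate k∈
        ... | inj₂ (there m)   = inj₂ (there m)
        ... | inj₂ (here refl) = ⊥-elim (crossing (<⇒≤ fp<fq) ≤-refl p<q)
        ... | inj₁ m           = ⊥-elim (crossing
                (<⇒≤ (Window.dominant W inᵖ k∈ ≤-refl (Window.later W inᵖ k∈)))
                (<⇒≤ (below-q (<⇒≤ (Window.later W inᵖ k∈)) (a<q m)))
                (Window.later W inᵖ k∈))

      end-r : ∀ {H} → H ∈ bs → ne H ∈ flatten r ⊎ ne H ∈ a
      end-r {i , k} H∈ = case-end (All.lookup endsʳ H∈)
        where
        i∈r = starts-in r startsʳ H∈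
        isH = proj₁ (All.lookup goodʳ H∈)
        i<q : i Fin.< q
        i<q = Window.later W (inʳ i∈r) q∈T
        -- The horizontal part of the root's hook would meet the vertical part of the right hook at
        -- (i, f q). A permitted contact there would require i = q or i = k.
        crossing : f q Fin.≤ f k → ⊥
        crossing fq≤fk with All.lookup compPQ H∈ i (f q)
            (inj₂ ((<⇒≤ (p<r i∈r) , <⇒≤ i<q) , refl))
            (inj₁ (refl , <⇒≤ (below-q (<⇒≤ (p<r i∈r)) i<q) , fq≤fk))
        ... | inj₁ ((i≡q , _) , _) = <-irrefl (cong toℕ i≡q) i<q
        ... | inj₂ ((i≡k , _) , _) = <-irrefl (cong toℕ i≡k) (proj₁ isH)
        case-end : k ∈ flatten (node l p r) ⊎ k ∈ T → k ∈ flatten r ⊎ k ∈ a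
        case-end (inj₁ k∈) = inj₁ (after k∈ (<-trans (p<r i∈r) (proj₁ isH)))
        case-end (inj₂ k∈) with locate k∈
        ... | inj₁ m           = inj₂ m
        ... | inj₂ (here refl) = ⊥-elim (crossing ≤-refl)
        ... | inj₂ (there m)   = ⊥-elim (crossing (<⇒≤ (fq<b m)))

-- Descents and hook configurations of a whole permutation

allFin-sorted : ∀ n → AllPairs Fin._<_ (allFin n)
allFin-sorted n = AllPairs.tabulate⁺-< id

map-lookup-allFin : (v : Vec X n) → map (lookup v) (allFin n) ≡ toList v
map-lookup-allFin v = trans (map-tabulate id (lookup v)) (tabulate-lookup v)

lookup⇒AllPairs : {R : Rel X 0ℓ} (v : Vec X n) → (∀ i j → i ≢ j → R (lookup v i) (lookup v j)) →
  AllPairs R (toList v)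
lookup⇒AllPairs []      r = []
lookup⇒AllPairs (x ∷ v) r =
  Allᵛ.toList⁺ (Allᵛ.lookup⁻ (λ i → r zero (suc i) λ ()))
  ∷ lookup⇒AllPairs v (λ i j i≢j → r (suc i) (suc j) (i≢j ∘ Fin.suc-injective))

AllPairs⇒lookup : {R : Rel X 0ℓ} → (∀ {x y} → R x y → R y x) → (v : Vec X n) → AllPairs R (toList v) →
  ∀ i j → i ≢ j → R (lookup v i) (lookup v j)
AllPairs⇒lookup s (x ∷ v) (rx ∷ rs) zero    zero    i≢j = contradiction refl i≢j
AllPairs⇒lookup s (x ∷ v) (rx ∷ rs) zero    (suc j) _   = Allᵛ.lookup⁺ (Allᵛ.toList⁻ rx) j
AllPairs⇒lookup s (x ∷ v) (rx ∷ rs) (suc i) zero    _   = s (Allᵛ.lookup⁺ (Allᵛ.toList⁻ rx) i)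
AllPairs⇒lookup s (x ∷ v) (rx ∷ rs) (suc i) (suc j) i≢j = AllPairs⇒lookup s v rs i j (i≢j ∘ cong suc)

lookup⇒map : (g : X → Y) (ys : List Y) (v : Vec X (length ys)) →
  (∀ i → g (lookup v i) ≡ List.lookup ys i) → map g (toList v) ≡ ys
lookup⇒map g []       []      eq = refl
lookup⇒map g (y ∷ ys) (x ∷ v) eq = cong₂ _∷_ (eq zero) (lookup⇒map g ys v (eq ∘ suc))

map⇒lookup : (g : X → Y) (ys : List Y) (v : Vec X (length ys)) →
  map g (toList v) ≡ ys → ∀ i → g (lookup v i) ≡ List.lookup ys i
map⇒lookup g (y ∷ ys) (x ∷ v) eq zero    = proj₁ (∷-injective eq)
map⇒lookup g (y ∷ ys) (x ∷ v) eq (suc i) = map⇒lookup g ys v (proj₂ (∷-injective eq)) i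

map-filter-vectors-↭ : ∀ {k} {P : Vec X k → Set} (P? : Decidable P) {xs : List X} {ws : List (List X)} →
  Unique xs → (∀ x → x ∈ xs) → Unique ws →
  (∀ v → P v → toList v ∈ ws) → (∀ {w} → w ∈ ws → ∃ λ v → toList v ≡ w × P v) →
  map toList (filter P? (vectors xs k)) ↭ ws
map-filter-vectors-↭ {k = k} P? {xs} {ws} xs! all ws! to from = unique-⊆⊇⇒↭
  (Unique.map⁺ (λ {u} {v} → toList-injective u v) (Unique.filter⁺ P? (vectors-unique xs! k)))
  ws! sub sup
  where
  sub : map toList (filter P? (vectors xs k)) ⊆ ws
  sub w∈ with v , v∈ , refl ← ∈-map⁻ toList w∈ = to v (proj₂ (∈-filter⁻ P? {xs = vectors xs k} v∈))
  sup : ws ⊆ map toList (filter P? (vectors xs k))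
  sup w∈ with v , refl , pv ← from w∈ = ∈-map⁺ toList (∈-filter⁺ P? (∈-vectors all v) pv)

module _ (π : Vec (Fin n) n) where

  private
    f : Fin n → Fin n
    f = lookup π

  sorted⇒ordered : ∀ P → AllPairs Fin._<_ (flatten P) → Ordered π P
  sorted⇒ordered leaf         _ = leaf
  sorted⇒ordered (node l p r) s with sˡ , pr@(p< ∷ sʳ) , l< ← AllPairs-++⁻ (flatten l) s =
    node (λ i∈ → l< i∈ (here refl)) (All.lookup p<) (sorted⇒ordered l sˡ) (sorted⇒ordered r sʳ)

  -- No descent leads out of the segment. The set of all positions satisfies this trivially, and a
  -- left subtree inherits it because the root, which comes next, is larger.
  Closed : Tree (Fin n) → Set
  Closed P = ∀ {i j} → i ∈ flatten P → toℕ j ≡ suc (toℕ i) → f j Fin.< f i → j ∈ flatten P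

  -- If p has a right subtree, the next position lies in it and has a smaller value. If it has none,
  -- a descent at p would lead out of the segment, against `Closed`.
  filter-descents : ∀ P T → Window π P T → Closed P → filter (isDescent? π) (flatten P) ≡ treeDescents P
  filter-descents leaf         T W closed = refl
  filter-descents (node l p r) T W closed = begin
    filter (isDescent? π) (flatten l ++ p ∷ flatten r)
      ≡⟨ filter-++ (isDescent? π) (flatten l) (p ∷ flatten r) ⟩
    filter (isDescent? π) (flatten l) ++ filter (isDescent? π) (p ∷ flatten r)
      ≡⟨ cong (_++ _) (filter-descents l (p ∷ T) (window-l id (Window.sorted W)) closed-l) ⟩
    treeDescents l ++ filter (isDescent? π) (p ∷ flatten r)
      ≡⟨ root r refl ⟩
    treeDescents (node l p r) ∎
    where
    open ≡-Reasoning
    open Split π W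
    closed-l : Closed l
    closed-l {i} {j} i∈ j≡ fj<fi = case-j (Fin.<-cmp j p)
      where
      case-j : Tri (j Fin.< p) (j ≡ p) (p Fin.< j) → j ∈ flatten l
      case-j (tri< j<p _ _)  = before (closed (inˡ i∈) j≡ fj<fi) j<p
      case-j (tri≈ _ refl _) = contradiction fj<fi (<-asym (heap-l i∈))
      case-j (tri> _ _ p<j)  = contradiction (≤-trans (≤-reflexive j≡) (l<p i∈)) (<⇒≱ p<j)
    closed-r : Closed r
    closed-r {i} {j} i∈ j≡ fj<fi =
      after (closed (inʳ i∈) j≡ fj<fi) (<-trans (p<r i∈) (≤-reflexive (sym j≡)))
    root : ∀ r′ → r ≡ r′ →
      treeDescents l ++ filter (isDescent? π) (p ∷ flatten r) ≡ treeDescents (node l p r′)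
    root leaf refl = trans (cong (treeDescents l ++_) (filter-reject (isDescent? π) p-ascent))
                           (++-identityʳ (treeDescents l))
      where
      p-ascent : ¬ IsDescent π p
      p-ascent (j , j≡ , fj<fp) with () ← after (closed inᵖ j≡ fj<fp) (≤-reflexive (sym j≡))
    root r′@(node r₁ y r₂) refl = cong (treeDescents l ++_)
      (trans (filter-accept (isDescent? π) (j , j≡ , heap-r j∈r))
             (cong (p ∷_) (filter-descents r T (window-r id (Window.sorted W)) closed-r)))
      where
      y∈r : y ∈ flatten r
      y∈r = ∈-++⁺ʳ (flatten r₁) (here refl)
      p+1<n : suc (toℕ p) < n
      p+1<n = ≤-<-trans (p<r y∈r) (Fin.toℕ<n y)
      j : Fin n
      j = fromℕ< p+1<n
      j≡ : toℕ j ≡ suc (toℕ p)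
      j≡ = Fin.toℕ-fromℕ< p+1<n
      p<j : p Fin.< j
      p<j = ≤-reflexive (sym j≡)
      j∈r : j ∈ flatten r
      j∈r = after (Window.convex W inᵖ (inʳ y∈r) (<⇒≤ p<j) (≤-trans (≤-reflexive j≡) (p<r y∈r))) p<j

  compatible-sym : ∀ {H K} → Compatible π H K → Compatible π K H
  compatible-sym c x y onK onH with c x y onH onK
  ... | inj₁ m = inj₂ m
  ... | inj₂ m = inj₁ m

  module _ (P : Tree (Fin n)) (P≡ : flatten P ≡ allFin n) (heap : Heap f P) where

    private
      ∈P : ∀ i → i ∈ flatten P
      ∈P i = subst (i ∈_) (sym P≡) (∈-allFin i)

    window-all : Window π P []
    window-all = record
      { ordered  = sorted⇒ordered P (subst (AllPairs Fin._<_) (sym P≡) (allFin-sorted n))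
      ; heap     = heap
      ; convex   = λ _ _ _ _ → ∈P _
      ; sorted   = []
      ; later    = λ _ ()
      ; dominant = λ _ ()
      }

    descents≡ : descents π ≡ treeDescents P
    descents≡ = trans (cong (filter (isDescent? π)) (sym P≡))
                      (filter-descents P [] window-all (λ _ _ _ → ∈P _))

    isVHC⇒valid : ∀ Hs → IsVHC π Hs → Valid π P [] (toList Hs)
    isVHC⇒valid Hs (hook , start , above , comp) = record
      { starts     = trans (lookup⇒map sw (descents π) Hs start) descents≡
      ; good       = Allᵛ.toList⁺ (Allᵛ.lookup⁻ (λ i → hook i , above i))
      ; compatible = lookup⇒AllPairs Hs comp
      ; ends       = All.tabulate (λ _ → inj₁ (∈P _))
      }

    valid⇒isVHC : ∀ Hs → Valid π P [] (toList Hs) → IsVHC π Hs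
    valid⇒isVHC Hs V =
        (λ i → proj₁ (good i))
      , map⇒lookup sw (descents π) Hs (trans (Valid.starts V) (sym descents≡))
      , (λ i → proj₂ (good i))
      , AllPairs⇒lookup compatible-sym Hs (Valid.compatible V)
      where
      good = Allᵛ.lookup⁺ (Allᵛ.toList⁻ (Valid.good V))

    valid⇒vector : ∀ {hs} → Valid π P [] hs → ∃ λ (Hs : Vec (Hook n) (length (descents π))) → toList Hs ≡ hs
    valid⇒vector {hs} V = toList-surjective hs (trans (sym (length-map sw hs))
                            (cong length (trans (Valid.starts V) (sym descents≡))))

    -- For the whole permutation no larger values stand to the right, so `T` is empty. Both sides
    -- list the valid configurations without repetition, and the order of the hooks is fixed by the
    -- descents.
    VHC↭configs : map toList (VHC π) ↭ configs P []
    VHC↭configs = map-filter-vectors-↭ (isVHC? π)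
      (Unique.cartesianProduct⁺ (Unique.allFin⁺ n) (Unique.allFin⁺ n))
      (λ (i , j) → ∈-cartesianProduct⁺ (∈-allFin i) (∈-allFin j))
      (configs-unique P [] (subst Unique (sym (trans (++-identityʳ (flatten P)) P≡)) (Unique.allFin⁺ n)))
      (λ Hs h → valid-configs π P [] window-all (isVHC⇒valid Hs h))
      (λ hs∈ → let V = configs-valid π P [] window-all hs∈
                   Hs , eq = valid⇒vector V
               in Hs , eq , valid⇒isVHC Hs (subst (Valid π P []) (sym eq) V))

    length-VHC : length (VHC π) ≡ hookCount P 0
    length-VHC = begin
      length (VHC π)               ≡⟨ length-map toList (VHC π) ⟨
      length (map toList (VHC π))  ≡⟨ Perm.↭-length VHC↭configs ⟩
      length (configs P [])        ≡⟨ length-configs P [] ⟩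
      hookCount P 0                    ∎
      where open ≡-Reasoning

VHC≡hookCount : ∀ (π : Vec (Fin n) n) T → toList π ≡ flatten T → Heap id T → length (VHC π) ≡ hookCount T 0
VHC≡hookCount {n} π T eq heap =
    let P , P≡ , mapP≡ = unflatten (lookup π) T (allFin n) (trans (map-lookup-allFin π) eq)
    in trans (length-VHC π P P≡ (heap-mapTree (lookup π) P (subst (Heap id) (sym mapP≡) heap)))
             (trans (sym (hookCount-mapTree (lookup π) P 0)) (cong (λ T′ → hookCount T′ 0) mapP≡))

theorem6p2 : (∀ (m n : ℕ) → m < n →
    D m n ≡ Σ[ 1 ⋯ m ] (λ j → Σ[ 1 ⋯ n ∸ m ∸ 1 ] (λ i →
    ((n ∸ m ∸ 1) C (i ∸ 1)) * D≥ j (i + j ∸ 1) * D≥ (m ∸ j) (n ∸ j ∸ i))))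
    × (∀ (n : ℕ) → 1 ≤ n → D n n ≡ 1)
theorem6p2 = recurrence D (D-trees VHC≡hookCount)
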